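{- Define polynomials $S_m(q)$ ($m\ge0$) by $S_0(q)=1$ and, for $m\ge1$, $$S_m(q)=q^{2m-1}S_{m-1}(q)+\sum_{k=0}^{m-1}q^{2(k+1)(m-1-k)}S_{m-1-k}(q)\,S_k(q).$$ For integers $n,t\ge0$ let $$S^{(t)}_n(q)=\left(q^{(i-j)(i-j-1)}S_{i+j+t}(q)\right)_{0\le i,j\le n-1}.$$ Let $n$ be a positive integer. (i) $$\det S^{(1)}_{n-1}(q)=\det S^{(0)}_n(q)=\prod_{k=1}^{n-1}\left(q^{2k-1}+1\right)^{n-k}.$$ (ii) $$\det S^{(2)}_n(q)=q^{ -1}\prod_{k=1}^{n}\left(q^{2k-1}+1\right)^{n+1-k}\left(\prod_{k=1}^{n+1}\left(q^{2k-1}+1\right)-1\right).$$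
   Context: $q$ is an indeterminate. The determinant of the empty ($0\times0$) matrix is $1$ and empty products equal $1$. -}

module Defs where

open import Algebra.Bundles.Raw using (RawRing)
import Algebra.Definitions.RawSemiring as RawSemiringDefs
open import Data.Fin.Base using (Fin; zero; suc; toℕ; opposite; punchIn)
open import Data.Fin.Properties using (opposite-prop; toℕ≤pred[n])
open import Data.Integer.Base as ℤ using (ℤ; 0ℤ; 1ℤ; +_; ∣_∣)
open import Data.List.Base using (List; []; _∷_; map)
open import Data.Nat.Base as ℕ using (ℕ; zero; suc; _∸_)
open import Data.Nat.Properties using (+-comm; m∸[m∸n]≡n)
open import Data.Vec.Base as Vec using (Vec; []; _∷_; lookup)
open import Level using (0ℓ)
open import Relation.Binary.PropositionalEquality
  using (_≡_; refl; sym; trans; cong; cong₂)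

-- ℤ[q]: a list holds the coefficients of q⁰, q¹, q², … in this order.  Trailing
-- zeros are allowed, so equality of polynomials is _≈_ and not _≡_ of lists.

Poly : Set
Poly = List ℤ

coeff : Poly → ℕ → ℤ
coeff []      _       = 0ℤ
coeff (a ∷ f) zero    = a
coeff (a ∷ f) (suc k) = coeff f k

infix 4 _≈ᴾ_
_≈ᴾ_ : Poly → Poly → Set
f ≈ᴾ g = ∀ k → coeff f k ≡ coeff g k

infixl 6 _+ᴾ_
_+ᴾ_ : Poly → Poly → Poly
[]      +ᴾ g       = g
(a ∷ f) +ᴾ []      = a ∷ f
(a ∷ f) +ᴾ (b ∷ g) = (a ℤ.+ b) ∷ (f +ᴾ g)

infixl 7 _*ᴾ_
_*ᴾ_ : Poly → Poly → Poly
[]      *ᴾ g = []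
(a ∷ f) *ᴾ g = map (a ℤ.*_) g +ᴾ (0ℤ ∷ (f *ᴾ g))

ℤ[q] : RawRing 0ℓ 0ℓ
ℤ[q] = record
  { Carrier = Poly
  ; _≈_     = _≈ᴾ_
  ; _+_     = _+ᴾ_
  ; _*_     = _*ᴾ_
  ; -_      = map (λ a → ℤ.- a)
  ; 0#      = []
  ; 1#      = 1ℤ ∷ []
  }

q : Poly
q = 0ℤ ∷ 1ℤ ∷ []

open RawRing ℤ[q] public using (_≈_; _+_; _*_; -_; 0#; 1#)
open RawSemiringDefs (RawRing.rawSemiring ℤ[q]) public using (_^_; sum; product)

infixl 6 _-_
_-_ : Poly → Poly → Poly
f - g = f + (- g)

-- ∏[1≤k≤ N ] f is the product of f 1, …, f N.
∏[1≤k≤_] : ℕ → (ℕ → Poly) → Poly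
∏[1≤k≤ N ] f = product {N} λ i → f (suc (toℕ i))

-- ℤ[q,q⁻¹]: f /q^ a stands for the Laurent polynomial q⁻ᵃ f.  Equality is by
-- cross-multiplication, which is sound as q is not a zero divisor in ℤ[q].

record Laurent : Set where
  constructor _/q^_
  field
    numerator : Poly
    order     : ℕ

infix 5 _/q^_

infix 4 _≈ᴸ_
_≈ᴸ_ : Laurent → Laurent → Set
(f /q^ a) ≈ᴸ (g /q^ b) = q ^ b * f ≈ q ^ a * g

infixl 7 _*ᴸ_
_*ᴸ_ : Laurent → Laurent → Laurent
(f /q^ a) *ᴸ (g /q^ b) = (f * g) /q^ (a ℕ.+ b)

q⁻¹ : Laurent
q⁻¹ = 1# /q^ 1

ι : Poly → Laurent
ι f = f /q^ 0

module _ {c ℓ} (R : RawRing c ℓ) where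
  private
    module R = RawRing R
    open RawSemiringDefs R.rawSemiring using () renaming (_^_ to _^ᴿ_; sum to sumᴿ)

  -- Laplace expansion along the first row.
  det : ∀ {n} → (Fin n → Fin n → R.Carrier) → R.Carrier
  det {zero}  M = R.1#
  det {suc n} M = sumᴿ λ j →
    ((R.- R.1#) ^ᴿ toℕ j) R.* M zero j R.* det (λ i k → M (suc i) (punchIn j k))

-- history m = S m ∷ S (m - 1) ∷ … ∷ S 0, so that in `next` the entry of h at
-- index k is S (m - k), and the one at index opposite k is S k.  The recurrence
-- in its usual form, for suc m in place of m, is S-suc below.

next : (m : ℕ) → Vec Poly (suc m) → Poly
next m h = q ^ (2 ℕ.* suc m ∸ 1) * Vec.head h
         + sum {suc m} λ k →
             q ^ (2 ℕ.* suc (toℕ k) ℕ.* (m ∸ toℕ k))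
               * lookup h k * lookup h (opposite k)

history : (m : ℕ) → Vec Poly (suc m)
history zero    = 1# ∷ []
history (suc m) = next m (history m) ∷ history m

S : ℕ → Poly
S m = Vec.head (history m)

lookup-history : ∀ m (k : Fin (suc m)) → lookup (history m) k ≡ S (m ∸ toℕ k)
lookup-history zero    zero    = refl
lookup-history (suc m) zero    = refl
lookup-history (suc m) (suc k) = lookup-history m k

lookup-history-opposite :
  ∀ m (k : Fin (suc m)) → lookup (history m) (opposite k) ≡ S (toℕ k)
lookup-history-opposite m k = trans (lookup-history m (opposite k)) (cong S
  (trans (cong (m ∸_) (opposite-prop k)) (m∸[m∸n]≡n (toℕ≤pred[n] k))))

sum-cong : ∀ {n} {f g : Fin n → Poly} → (∀ i → f i ≡ g i) → sum f ≡ sum g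
sum-cong {zero}  e = refl
sum-cong {suc n} e = cong₂ _+_ (e zero) (sum-cong λ i → e (suc i))

S-suc : ∀ m → S (suc m) ≡
  q ^ (2 ℕ.* suc m ∸ 1) * S m
    + sum {suc m} λ k →
        q ^ (2 ℕ.* (toℕ k ℕ.+ 1) ℕ.* (suc m ∸ 1 ∸ toℕ k))
          * S (suc m ∸ 1 ∸ toℕ k) * S (toℕ k)
S-suc m = cong (λ s → q ^ (2 ℕ.* suc m ∸ 1) * S m + s) (sum-cong λ k → cong₂ _*_
  (cong₂ _*_
    (cong (λ s → q ^ (2 ℕ.* s ℕ.* (m ∸ toℕ k))) (+-comm 1 (toℕ k)))
    (lookup-history m k))
  (lookup-history-opposite m k))

-- A product of two consecutive integers is nonnegative, so the absolute value,
-- which only makes the exponent a natural number, does not change it.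
exponent : ℕ → ℕ → ℕ
exponent i j = ∣ (+ i ℤ.- + j) ℤ.* (+ i ℤ.- + j ℤ.- 1ℤ) ∣

S-matrix : (t n : ℕ) → Fin n → Fin n → Poly
S-matrix t n i j =
  q ^ exponent (toℕ i) (toℕ j) * S (toℕ i ℕ.+ toℕ j ℕ.+ t)

{-# OPTIONS --safe #-}

-- In terms of p = q⁻¹ and T_m = p^(m²) S_m the recurrence becomes
-- T_(m+1) = T_m + Σ_k p^(2k+1) T_k T_(m−k), and det S^(t)_n is, up to factors taken out
-- of rows and columns, the Hankel determinant of (T_(i+j+t)).  The generating function
-- of T is the Stieltjes continued fraction with the coefficients
--   a_k = p^(2k) (p^(2k+1) + 1),  b_k = p^(4k+3)   in the order a₀, b₀, a₁, b₁, …,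
-- because removing two levels from its Dyck paths multiplies the weights of the
-- contracted paths by powers of p².  For t = 0 and t = 1 the path counts by final height
-- give a triangular factorization of the Hankel matrix, whose determinant is then a
-- product of the a_k and b_k.  For t = 2 one of the two triangular factors is shifted by
-- a row; its determinant is a continuant, which solves a two-term recurrence that
-- telescopes to the difference in (ii).

module Submission where

open import Defs using (det; exponent)
open import Algebra.Bundles using (CommutativeRing; Monoid; Semiring)
open import Algebra.Bundles.Raw using (RawRing)
import Algebra.Definitions.RawSemiring as RawSemiringDefs
open import Algebra.Morphism.Structures using (IsMonoidHomomorphism; IsRingHomomorphism)
open import Data.Fin.Base as Fin using (Fin; zero; suc; toℕ; fromℕ; inject₁; punchIn; punchOut)
open import Data.Fin.Induction using (<-weakInduction)
open import Data.Fin.Properties as Fin using (_≟_)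
open import Data.Integer.Base as ℤ using (ℤ; 0ℤ; 1ℤ; +_)
import Data.Integer.Properties as ℤ
import Data.Integer.Tactic.RingSolver as ℤSolver
open import Data.List.Base using ([]; _∷_; map)
open import Data.Nat.Base as ℕ using (ℕ; zero; suc; _∸_; NonZero)
open import Data.Nat.Induction using (<-rec)
import Data.Nat.Properties as ℕ
import Data.Nat.Tactic.RingSolver as ℕSolver
open import Data.Product.Base using (_×_; _,_; ∃)
open import Data.Sum.Base using (_⊎_; inj₁; inj₂)
open import Data.Vec.Functional using (updateAt; removeAt)
open import Data.Vec.Functional.Properties using (updateAt-updates; updateAt-minimal)
open import Function.Base using (_∘_; const)
open import Level using (0ℓ; _⊔_)
open import Relation.Binary.Definitions using (tri<; tri≈; tri>)
open import Relation.Binary.PropositionalEquality as ≡ using (_≡_; _≢_)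
open import Relation.Nullary using (¬_; yes; no; contradiction)

-- Determinants

-- For the generating function F of T the recurrence reads F(x) = 1 + x F(x) + p x F(p² x) F(x), so
-- the continued fraction has to reproduce the dilation of x by p². The a_k are not geometric in k;
-- only the contracted weights scale. Taken two steps at a time, paths at the even heights 2k + 2
-- have level weights b_k + a_(k+1) and return weights a_(k+1) b_(k+1), and these are p² and p⁴
-- times the weights a_k + b_k and b_k a_(k+1) at the odd heights 2k + 1. This is why paths are
-- recorded in two arrays, one for each parity of the height. The obstacle is that p does not lie in
-- ℤ[q]. The whole computation therefore takes place in an arbitrary commutative ring with q p = 1,
-- with explicit triangular factors and no division, and is then applied to a ring of fractions into
-- which ℤ[q] embeds, so that equalities descend. Formula (ii) descends after multiplication by q.

module _ {c ℓ} (M : Monoid c ℓ) where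
  open Monoid M
  open import Algebra.Properties.Monoid.Sum M using (sum; sum-init-last; sum-cong-≗)

  -- Sums and products unfold at their first index, whereas the recurrences below grow at the last
  -- one. A general monoid covers both cases.
  sum-toℕ-last : ∀ (f : ℕ → Carrier) n →
                 sum {suc n} (f ∘ toℕ) ≈ sum {n} (f ∘ toℕ) ∙ f n
  sum-toℕ-last f n = trans (sum-init-last (f ∘ toℕ)) (reflexive (≡.cong₂ _∙_
    (sum-cong-≗ {n} (λ i → ≡.cong f (Fin.toℕ-inject₁ i))) (≡.cong f (Fin.toℕ-fromℕ n))))

punchIn-inject₁-self : ∀ {n} (j : Fin n) → punchIn (inject₁ j) j ≡ suc j
punchIn-inject₁-self zero    = ≡.refl
punchIn-inject₁-self (suc j) = ≡.cong suc (punchIn-inject₁-self j)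

-- Deleting one or the other of two neighbouring columns leaves the same list of columns, except at
-- the place where the surviving neighbour stands.
punchIn-adjacent : ∀ {n} (j k : Fin n) →
  punchIn (inject₁ j) k ≡ punchIn (suc j) k ⊎
  (punchIn (inject₁ j) k ≡ suc j × punchIn (suc j) k ≡ inject₁ j)
punchIn-adjacent zero    zero    = inj₂ (≡.refl , ≡.refl)
punchIn-adjacent zero    (suc k) = inj₁ ≡.refl
punchIn-adjacent (suc j) zero    = inj₁ ≡.refl
punchIn-adjacent (suc j) (suc k) with punchIn-adjacent j k
... | inj₁ e       = inj₁ (≡.cong suc e)
... | inj₂ (e , f) = inj₂ (≡.cong suc e , ≡.cong suc f)

-- punchIn (inject₁ j) (punchIn j l) runs over the indices other than inject₁ j and suc j.
punchIn-keeps-adjacent : ∀ {n} (j : Fin (suc n)) (l : Fin n) →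
  ∃ λ j′ → punchIn (punchIn (inject₁ j) (punchIn j l)) (inject₁ j′) ≡ inject₁ j
         × punchIn (punchIn (inject₁ j) (punchIn j l)) (suc j′) ≡ suc j
punchIn-keeps-adjacent zero    zero    = zero , ≡.refl , ≡.refl
punchIn-keeps-adjacent zero    (suc l) = zero , ≡.refl , ≡.refl
punchIn-keeps-adjacent (suc j) zero    = j , ≡.refl , ≡.refl
punchIn-keeps-adjacent (suc j) (suc l) with punchIn-keeps-adjacent j l
... | j′ , e , f = suc j′ , ≡.cong suc e , ≡.cong suc f

module Determinant {c ℓ} (R : CommutativeRing c ℓ) where
  open CommutativeRing R hiding (zero)
  open import Algebra.Properties.Semiring.Sum semiring
  open import Algebra.Properties.Ring ring using (-1*x≈-x)
  open import Algebra.Definitions.RawSemiring (Semiring.rawSemiring semiring) using (_^_; product)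
  open import Algebra.Properties.CommutativeMonoid.Sum *-commutativeMonoid using ()
    renaming (∑-distrib-+ to product-distrib-*)
  open import Algebra.Solver.Ring.NaturalCoefficients.Default commutativeSemiring
    using (solve; _:=_; _:+_; _:*_)
  open import Relation.Binary.Reasoning.Setoid setoid

  Matrix : ℕ → Set c
  Matrix n = Fin n → Fin n → Carrier

  ∣_∣ : ∀ {n} → Matrix n → Carrier
  ∣_∣ = det rawRing

  minor : ∀ {n} → Matrix (suc n) → Fin (suc n) → Matrix n
  minor M j i k = M (suc i) (punchIn j k)

  sign : ℕ → Carrier
  sign k = (- 1#) ^ k

  term : ∀ {n} → Matrix (suc n) → Fin (suc n) → Carrier
  term M j = sign (toℕ j) * M zero j * ∣ minor M j ∣

  infixl 9 _[_]≔_
  _[_]≔_ : ∀ {n} → Matrix n → Fin n → (Fin n → Carrier) → Matrix n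
  (M [ j ]≔ v) i = updateAt (M i) j (const (v i))

  []≔-updates : ∀ {n} (M : Matrix n) j v i → (M [ j ]≔ v) i j ≈ v i
  []≔-updates M j v i = reflexive (updateAt-updates j (M i))

  []≔-minimal : ∀ {n} (M : Matrix n) j v i {k} → k ≢ j → (M [ j ]≔ v) i k ≈ M i k
  []≔-minimal M j v i {k} k≢j = reflexive (updateAt-minimal k j (M i) k≢j)

  sum-zero : ∀ {n} {t : Fin n → Carrier} → (∀ i → t i ≈ 0#) → sum t ≈ 0#
  sum-zero {n} t≈0 = trans (sum-cong-≋ t≈0) (sum-replicate-zero n)

  sum-single : ∀ {n} (t : Fin n → Carrier) j → (∀ k → k ≢ j → t k ≈ 0#) → sum t ≈ t j
  sum-single {suc n} t j t≈0 = begin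
    sum t                    ≈⟨ sum-remove t ⟩
    t j + sum (removeAt t j) ≈⟨ +-congˡ (sum-zero (λ k → t≈0 _ (Fin.punchInᵢ≢i j k))) ⟩
    t j + 0#                 ≈⟨ +-identityʳ (t j) ⟩
    t j                      ∎

  x+-1*x≈0 : ∀ x → x + - 1# * x ≈ 0#
  x+-1*x≈0 x = trans (+-congˡ (-1*x≈-x x)) (-‿inverseʳ x)

  det-cong : ∀ {n} {M N : Matrix n} → (∀ i j → M i j ≈ N i j) → ∣ M ∣ ≈ ∣ N ∣
  det-cong {zero}  M≈N = refl
  det-cong {suc n} {M} {N} M≈N = sum-cong-≋ {suc n} {term M} {term N} λ j →
    *-cong (*-congˡ (M≈N zero j)) (det-cong λ i k → M≈N (suc i) (punchIn j k))

  -- Laplace expansion along the first row: in the term of column j the entry carries the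
  -- combination and the minors agree; in any other term the minor carries it, in the column that j
  -- becomes after the deletion. Arbitrarily many summands are allowed because a column will be
  -- replaced by a combination of all columns.
  det-linear : ∀ {n m} (j : Fin n) {L : Matrix n} (w : Fin m → Carrier) (N : Fin m → Matrix n) →
               (∀ i → L i j ≈ sum λ k → w k * N k i j) →
               (∀ k i l → l ≢ j → L i l ≈ N k i l) →
               ∣ L ∣ ≈ sum λ k → w k * ∣ N k ∣
  det-linear {suc n} {m} j {L} w N at-j off-j = begin
    sum (term L)                                  ≈⟨ sum-cong-≋ expand ⟩
    (sum λ l → sum λ k → w k * term (N k) l)      ≈⟨ ∑-comm (λ l k → w k * term (N k) l) ⟩
    (sum λ k → sum λ l → w k * term (N k) l)      ≈⟨ sum-cong-≋ (λ k → *-distribˡ-sum (w k) (term (N k))) ⟨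
    (sum λ k → w k * sum (term (N k)))            ∎
    where
    expand : ∀ l → term L l ≈ sum λ k → w k * term (N k) l
    expand l with l ≟ j
    ... | yes ≡.refl = begin
      sign (toℕ l) * L zero l * ∣ minor L l ∣
        ≈⟨ *-congʳ (*-congˡ (at-j zero)) ⟩
      sign (toℕ l) * (sum λ k → w k * N k zero l) * ∣ minor L l ∣
        ≈⟨ *-congʳ (*-distribˡ-sum (sign (toℕ l)) (λ k → w k * N k zero l)) ⟩
      (sum λ k → sign (toℕ l) * (w k * N k zero l)) * ∣ minor L l ∣
        ≈⟨ *-distribʳ-sum _ (λ k → sign (toℕ l) * (w k * N k zero l)) ⟩
      (sum λ k → sign (toℕ l) * (w k * N k zero l) * ∣ minor L l ∣)
        ≈⟨ sum-cong-≋ (λ k → trans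
             (*-congˡ (det-cong λ i h → off-j k (suc i) (punchIn l h) (Fin.punchInᵢ≢i l h)))
             (solve 4 (λ s w a d → (s :* (w :* a)) :* d := w :* ((s :* a) :* d)) refl _ _ _ _)) ⟩
      (sum λ k → w k * term (N k) l) ∎
    ... | no l≢j = begin
      sign (toℕ l) * L zero l * ∣ minor L l ∣
        ≈⟨ *-congˡ (det-linear j′ {minor L l} w (λ k → minor (N k) l) at-j′ off-j′) ⟩
      sign (toℕ l) * L zero l * (sum λ k → w k * ∣ minor (N k) l ∣)
        ≈⟨ *-distribˡ-sum _ (λ k → w k * ∣ minor (N k) l ∣) ⟩
      (sum λ k → sign (toℕ l) * L zero l * (w k * ∣ minor (N k) l ∣))
        ≈⟨ sum-cong-≋ (λ k → trans
             (*-congʳ (*-congˡ (off-j k zero l l≢j)))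
             (solve 4 (λ s w a d → (s :* a) :* (w :* d) := w :* ((s :* a) :* d)) refl _ _ _ _)) ⟩
      (sum λ k → w k * term (N k) l) ∎
      where
      j′ = punchOut l≢j
      at-j′ : ∀ i → minor L l i j′ ≈ sum λ k → w k * minor (N k) l i j′
      at-j′ i = ≡.subst (λ h → L (suc i) h ≈ sum λ k → w k * N k (suc i) h)
                  (≡.sym (Fin.punchIn-punchOut l≢j)) (at-j (suc i))
      off-j′ : ∀ k i h → h ≢ j′ → minor L l i h ≈ minor (N k) l i h
      off-j′ k i h h≢j′ = off-j k (suc i) (punchIn l h) λ e →
        h≢j′ (Fin.punchIn-injective l h j′ (≡.trans e (≡.sym (Fin.punchIn-punchOut l≢j))))

  det-additive : ∀ {n} (j : Fin n) {L M N : Matrix n} →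
                 (∀ i → L i j ≈ M i j + N i j) →
                 (∀ i l → l ≢ j → L i l ≈ M i l) →
                 (∀ i l → l ≢ j → L i l ≈ N i l) →
                 ∣ L ∣ ≈ ∣ M ∣ + ∣ N ∣
  det-additive {n} j {L} {M} {N} at-j off-M off-N = trans
    (det-linear {m = 2} j {L} (λ _ → 1#) MN (λ i → trans (at-j i) (sym (two _ _)))
      λ { zero → off-M ; (suc zero) → off-N })
    (two _ _)
    where
    MN : Fin 2 → Matrix n
    MN zero       = M
    MN (suc zero) = N
    two : ∀ x y → 1# * x + (1# * y + 0#) ≈ x + y
    two x y = +-cong (*-identityˡ x) (trans (+-identityʳ _) (*-identityˡ y))

  -- The terms of the two equal columns have opposite signs and equal minors, so they cancel; every
  -- other minor still contains the two columns side by side and vanishes by induction.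
  det-alternating-adjacent : ∀ {n} (j : Fin n) (M : Matrix (suc n)) →
    (∀ i → M i (inject₁ j) ≈ M i (suc j)) → ∣ M ∣ ≈ 0#
  det-alternating-adjacent {suc n} j M equal = begin
    sum (term M)
      ≈⟨ sum-remove {i = inject₁ j} (term M) ⟩
    term M (inject₁ j) + sum (removeAt (term M) (inject₁ j))
      ≈⟨ +-congˡ (sum-remove {i = j} (removeAt (term M) (inject₁ j))) ⟩
    term M (inject₁ j) + (term M (punchIn (inject₁ j) j) + sum (λ l → term M (punchIn (inject₁ j) (punchIn j l))))
      ≈⟨ +-congˡ (+-cong (reflexive (≡.cong (term M) (punchIn-inject₁-self j))) (sum-zero others)) ⟩
    term M (inject₁ j) + (term M (suc j) + 0#)
      ≈⟨ +-cong (*-congʳ (*-congʳ (reflexive (≡.cong sign (Fin.toℕ-inject₁ j))))) (+-identityʳ _) ⟩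
    sign (toℕ j) * M zero (inject₁ j) * ∣ minor M (inject₁ j) ∣ + term M (suc j)
      ≈⟨ +-congʳ (*-cong (*-congˡ (equal zero)) (det-cong same-minor)) ⟩
    sign (toℕ j) * M zero (suc j) * ∣ minor M (suc j) ∣ + - 1# * sign (toℕ j) * M zero (suc j) * ∣ minor M (suc j) ∣
      ≈⟨ +-congˡ (trans (*-congʳ (*-assoc _ _ _)) (*-assoc _ _ _)) ⟩
    sign (toℕ j) * M zero (suc j) * ∣ minor M (suc j) ∣ + - 1# * (sign (toℕ j) * M zero (suc j) * ∣ minor M (suc j) ∣)
      ≈⟨ x+-1*x≈0 _ ⟩
    0# ∎
    where
    same-minor : ∀ i k → minor M (inject₁ j) i k ≈ minor M (suc j) i k
    same-minor i k with punchIn-adjacent j k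
    ... | inj₁ e       = reflexive (≡.cong (M (suc i)) e)
    ... | inj₂ (e , f) = trans (reflexive (≡.cong (M (suc i)) e))
      (trans (sym (equal (suc i))) (reflexive (≡.cong (M (suc i)) (≡.sym f))))
    others : ∀ l → term M (punchIn (inject₁ j) (punchIn j l)) ≈ 0#
    others l with punchIn-keeps-adjacent j l
    ... | j′ , e , f = trans
      (*-congˡ (det-alternating-adjacent j′ (minor M (punchIn (inject₁ j) (punchIn j l))) λ i →
        trans (reflexive (≡.cong (M (suc i)) e))
          (trans (equal (suc i)) (reflexive (≡.cong (M (suc i)) (≡.sym f))))))
      (zeroʳ _)

  -- Induction on the right-hand column of the equal pair, which is moved one place to the left by
  -- polarization: with D as a function of the columns at a and b + 1, D (w + v) (w + v) expands
  -- into four terms. D w w and D v v vanish by adjacency, D v w by the induction hypothesis, and D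
  -- w v is the determinant in question.
  det-alternating-< : ∀ {n} (k : Fin (suc n)) (M : Matrix (suc n)) j → j Fin.< k →
                      (∀ i → M i j ≈ M i k) → ∣ M ∣ ≈ 0#
  det-alternating-< = <-weakInduction P (λ _ _ ()) step
    where
    P : Fin (suc _) → Set _
    P k = ∀ M j → j Fin.< k → (∀ i → M i j ≈ M i k) → ∣ M ∣ ≈ 0#

    step : ∀ b → P (inject₁ b) → P (suc b)
    step b IH M j j≤b equal with j ≟ inject₁ b
    ... | yes ≡.refl = det-alternating-adjacent b M equal
    ... | no j≢a = begin
      ∣ M ∣                                ≈⟨ det-cong M≈D[w,v] ⟩
      D w v                                ≈⟨ +-identityˡ _ ⟨
      0# + D w v                           ≈⟨ +-congʳ (adjacent w) ⟨
      D w w + D w v                        ≈⟨ additiveʳ w w v ⟨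
      D w w+v                              ≈⟨ +-identityʳ _ ⟨
      D w w+v + 0#                         ≈⟨ +-congˡ D[v,w+v]≈0 ⟨
      D w w+v + D v w+v                    ≈⟨ additiveˡ w v w+v ⟨
      D w+v w+v                            ≈⟨ adjacent w+v ⟩
      0#                                   ∎
      where
      a = inject₁ b
      a≢b : a ≢ suc b
      a≢b e = ℕ.m≢1+m+n (toℕ b) (≡.trans (≡.sym (Fin.toℕ-inject₁ b))
        (≡.trans (≡.cong toℕ e) (≡.cong suc (≡.sym (ℕ.+-identityʳ (toℕ b))))))
      b≢a = a≢b ∘ ≡.sym
      j≢b : j ≢ suc b
      j≢b e = ℕ.<-irrefl (≡.cong toℕ e) j≤b
      j<a : j Fin.< a
      j<a = ℕ.≤∧≢⇒< (≡.subst (toℕ j ℕ.≤_) (≡.sym (Fin.toℕ-inject₁ b)) (ℕ.s≤s⁻¹ j≤b))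
                    (j≢a ∘ Fin.toℕ-injective)
      w v w+v : Fin _ → Carrier
      w i   = M i a
      v i   = M i (suc b)
      w+v i = w i + v i
      N : (_ _ : Fin _ → Carrier) → Matrix _
      N x y = M [ a ]≔ x [ suc b ]≔ y
      D : (_ _ : Fin _ → Carrier) → Carrier
      D x y = ∣ N x y ∣

      at-b : ∀ x y i → N x y i (suc b) ≈ y i
      at-b x y = []≔-updates (M [ a ]≔ x) (suc b) y
      at-a : ∀ x y i → N x y i a ≈ x i
      at-a x y i = trans ([]≔-minimal (M [ a ]≔ x) (suc b) y i a≢b) ([]≔-updates M a x i)
      off-b : ∀ x y y′ i l → l ≢ suc b → N x y i l ≈ N x y′ i l
      off-b x y y′ i l l≢b =
        trans ([]≔-minimal (M [ a ]≔ x) (suc b) y i l≢b) (sym ([]≔-minimal (M [ a ]≔ x) (suc b) y′ i l≢b))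
      off-ab : ∀ x y i l → l ≢ a → l ≢ suc b → N x y i l ≈ M i l
      off-ab x y i l l≢a l≢b =
        trans ([]≔-minimal (M [ a ]≔ x) (suc b) y i l≢b) ([]≔-minimal M a x i l≢a)
      off-a : ∀ x x′ y i l → l ≢ a → N x y i l ≈ N x′ y i l
      off-a x x′ y i l l≢a with l ≟ suc b
      ... | yes ≡.refl = trans (at-b x y i) (sym (at-b x′ y i))
      ... | no l≢b     = trans (off-ab x y i l l≢a l≢b) (sym (off-ab x′ y i l l≢a l≢b))

      M≈D[w,v] : ∀ i l → M i l ≈ N w v i l
      M≈D[w,v] i l with l ≟ a | l ≟ suc b
      ... | yes ≡.refl | _          = sym (at-a w v i)
      ... | no _       | yes ≡.refl = sym (at-b w v i)
      ... | no l≢a     | no l≢b     = sym (off-ab w v i l l≢a l≢b)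

      adjacent : ∀ x → D x x ≈ 0#
      adjacent x = det-alternating-adjacent b (N x x) λ i → trans (at-a x x i) (sym (at-b x x i))
      additiveʳ : ∀ x y y′ → D x (λ i → y i + y′ i) ≈ D x y + D x y′
      additiveʳ x y y′ = det-additive (suc b) {N x λ i → y i + y′ i} {N x y} {N x y′}
        (λ i → trans (at-b x (λ h → y h + y′ h) i) (sym (+-cong (at-b x y i) (at-b x y′ i))))
        (off-b x (λ h → y h + y′ h) y) (off-b x (λ h → y h + y′ h) y′)
      additiveˡ : ∀ x x′ y → D (λ i → x i + x′ i) y ≈ D x y + D x′ y
      additiveˡ x x′ y = det-additive a {N (λ i → x i + x′ i) y} {N x y} {N x′ y}
        (λ i → trans (at-a (λ h → x h + x′ h) y i) (sym (+-cong (at-a x y i) (at-a x′ y i))))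
        (off-a (λ h → x h + x′ h) x y) (off-a (λ h → x h + x′ h) x′ y)
      D[v,w]≈0 : D v w ≈ 0#
      D[v,w]≈0 = IH (N v w) j j<a λ i →
        trans (off-ab v w i j j≢a j≢b) (trans (equal i) (sym (at-a v w i)))
      D[v,w+v]≈0 : D v w+v ≈ 0#
      D[v,w+v]≈0 = trans (additiveʳ v w v) (trans (+-cong D[v,w]≈0 (adjacent v)) (+-identityˡ 0#))

  det-alternating : ∀ {n} (M : Matrix n) {j k} → j ≢ k → (∀ i → M i j ≈ M i k) → ∣ M ∣ ≈ 0#
  det-alternating {suc n} M {j} {k} j≢k equal with Fin.<-cmp j k
  ... | tri< j<k _ _ = det-alternating-< k M j j<k equal
  ... | tri≈ _ j≡k _ = contradiction j≡k j≢k
  ... | tri> _ _ k<j = det-alternating-< j M k k<j (sym ∘ equal)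

  -- The computation behind Cramer's rule: after expansion by linearity, each k other than j puts a
  -- second copy of column k in place j, so only the summand at j survives.
  det-column-combination : ∀ {n} {M N : Matrix n} j (w : Fin n → Carrier) →
    (∀ i → N i j ≈ sum λ k → M i k * w k) →
    (∀ i l → l ≢ j → N i l ≈ M i l) →
    ∣ N ∣ ≈ ∣ M ∣ * w j
  det-column-combination {n} {M} {N} j w at-j off-j = begin
    ∣ N ∣
      ≈⟨ det-linear j w (λ k → M [ j ]≔ λ i → M i k)
           (λ i → trans (at-j i) (sum-cong-≋ λ k →
             trans (*-comm _ _) (*-congˡ (sym ([]≔-updates M j (λ h → M h k) i)))))
           (λ k i l l≢j → trans (off-j i l l≢j) (sym ([]≔-minimal M j (λ h → M h k) i l≢j))) ⟩
    (sum λ k → w k * ∣ M [ j ]≔ (λ i → M i k) ∣)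
      ≈⟨ sum-single _ j (λ k k≢j → trans (*-congˡ (repeated k k≢j)) (zeroʳ (w k))) ⟩
    w j * ∣ M [ j ]≔ (λ i → M i j) ∣
      ≈⟨ *-congˡ (det-cong unchanged) ⟩
    w j * ∣ M ∣
      ≈⟨ *-comm _ _ ⟩
    ∣ M ∣ * w j ∎
    where
    repeated : ∀ k → k ≢ j → ∣ M [ j ]≔ (λ i → M i k) ∣ ≈ 0#
    repeated k k≢j = det-alternating (M [ j ]≔ λ i → M i k) k≢j λ i →
      trans ([]≔-minimal M j (λ h → M h k) i k≢j) (sym ([]≔-updates M j (λ h → M h k) i))
    unchanged : ∀ i l → (M [ j ]≔ (λ i → M i j)) i l ≈ M i l
    unchanged i l with l ≟ j
    ... | yes ≡.refl = []≔-updates M l (λ h → M h l) i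
    ... | no l≢j     = []≔-minimal M j (λ h → M h j) i l≢j

  -- The columns of `AU` are exchanged for those of `A` one at a time, from the left: `stage s`
  -- shows `A` before column s and `AU` from there on. By triangularity column j of `AU` involves
  -- only the columns k ≤ j of `A`, all of which are visible in `stage (suc j)`, so each exchange is
  -- a column combination with coefficient U j j.
  det-*-upper : ∀ {n} (A U : Matrix n) (d : ℕ → Carrier) →
    (∀ k j → j Fin.< k → U k j ≈ 0#) → (∀ j → U j j ≈ d (toℕ j)) →
    ∣ (λ i j → sum λ k → A i k * U k j) ∣ ≈ ∣ A ∣ * product {n} (d ∘ toℕ)
  det-*-upper {n} A U d upper diagonal = begin
    ∣ AU ∣                              ≈⟨ stages n ℕ.≤-refl ⟩
    ∣ stage n ∣ * product {n} (d ∘ toℕ) ≈⟨ *-congʳ (det-cong λ i j → stage-< i (Fin.toℕ<n j)) ⟩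
    ∣ A ∣ * product {n} (d ∘ toℕ)       ∎
    where
    AU : Matrix n
    AU i j = sum λ k → A i k * U k j

    stage : ℕ → Matrix n
    stage s i j with toℕ j ℕ.<? s
    ... | yes _ = A i j
    ... | no  _ = AU i j

    stage-< : ∀ {s} i {j} → toℕ j ℕ.< s → stage s i j ≈ A i j
    stage-< {s} i {j} j<s with toℕ j ℕ.<? s
    ... | yes _  = refl
    ... | no j≮s = contradiction j<s j≮s

    stage-≮ : ∀ {s} i {j} → ¬ toℕ j ℕ.< s → stage s i j ≈ AU i j
    stage-≮ {s} i {j} j≮s with toℕ j ℕ.<? s
    ... | yes j<s = contradiction j<s j≮s
    ... | no _    = refl

    stage-suc : ∀ (j : Fin n) → ∣ stage (toℕ j) ∣ ≈ ∣ stage (suc (toℕ j)) ∣ * d (toℕ j)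
    stage-suc j = trans
      (det-column-combination j (λ k → U k j)
        (λ i → trans (stage-≮ i (ℕ.<-irrefl ≡.refl)) (sum-cong-≋ (summand i))) off-j)
      (*-congˡ (diagonal j))
      where
      summand : ∀ i k → A i k * U k j ≈ stage (suc (toℕ j)) i k * U k j
      summand i k with k Fin.≤? j
      ... | yes k≤j = *-congʳ (sym (stage-< i (ℕ.s≤s k≤j)))
      ... | no k≰j  = trans (vanish _) (sym (vanish _))
        where
        vanish : ∀ x → x * U k j ≈ 0#
        vanish x = trans (*-congˡ (upper k j (ℕ.≰⇒> k≰j))) (zeroʳ x)
      off-j : ∀ i l → l ≢ j → stage (toℕ j) i l ≈ stage (suc (toℕ j)) i l
      off-j i l l≢j with Fin.<-cmp l j
      ... | tri< l<j _ _ = trans (stage-< i l<j) (sym (stage-< i (ℕ.m<n⇒m<1+n l<j)))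
      ... | tri≈ _ l≡j _ = contradiction l≡j l≢j
      ... | tri> _ _ j<l = trans (stage-≮ i (ℕ.<-asym j<l)) (sym (stage-≮ i (ℕ.≤⇒≯ j<l)))

    stages : ∀ s → s ℕ.≤ n → ∣ AU ∣ ≈ ∣ stage s ∣ * product {s} (d ∘ toℕ)
    stages zero    _   = sym (trans (*-identityʳ _) (det-cong {M = stage 0} λ i j → stage-≮ {0} i {j} λ ()))
    stages (suc s) s<n = begin
      ∣ AU ∣                                            ≈⟨ stages s (ℕ.<⇒≤ s<n) ⟩
      ∣ stage s ∣ * product {s} (d ∘ toℕ)               ≈⟨ *-congʳ step ⟩
      ∣ stage (suc s) ∣ * d s * product {s} (d ∘ toℕ)   ≈⟨ *-assoc _ _ _ ⟩
      ∣ stage (suc s) ∣ * (d s * product {s} (d ∘ toℕ)) ≈⟨ *-congˡ (*-comm _ _) ⟩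
      ∣ stage (suc s) ∣ * (product {s} (d ∘ toℕ) * d s) ≈⟨ *-congˡ (sum-toℕ-last *-monoid d s) ⟨
      ∣ stage (suc s) ∣ * product {suc s} (d ∘ toℕ)     ∎
      where
      step : ∣ stage s ∣ ≈ ∣ stage (suc s) ∣ * d s
      step = ≡.subst (λ x → ∣ stage x ∣ ≈ ∣ stage (suc x) ∣ * d x) (Fin.toℕ-fromℕ< s<n)
               (stage-suc (Fin.fromℕ< s<n))

  det-lower : ∀ {n} (A : Matrix n) (d : ℕ → Carrier) →
    (∀ i j → i Fin.< j → A i j ≈ 0#) → (∀ i → A i i ≈ d (toℕ i)) →
    ∣ A ∣ ≈ product {n} (d ∘ toℕ)
  det-lower {zero}  A d lower diagonal = refl
  det-lower {suc n} A d lower diagonal = begin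
    sum (term A)                    ≈⟨ sum-single (term A) zero off ⟩
    1# * A zero zero * ∣ minor A zero ∣
      ≈⟨ *-cong (trans (*-identityˡ _) (diagonal zero))
           (det-lower (minor A zero) (d ∘ suc) (λ i j i<j → lower (suc i) (suc j) (ℕ.s≤s i<j)) (diagonal ∘ suc)) ⟩
    d 0 * product {n} (d ∘ suc ∘ toℕ) ∎
    where
    off : ∀ j → j ≢ zero → term A j ≈ 0#
    off zero    j≢0 = contradiction ≡.refl j≢0
    off (suc j) _   = trans (*-congʳ (trans (*-congˡ (lower zero (suc j) ℕ.z<s)) (zeroʳ _))) (zeroˡ _)

  det-triangular-product : ∀ {n} (A U : Matrix n) (a d : ℕ → Carrier) →
    (∀ i j → i Fin.< j → A i j ≈ 0#) → (∀ i → A i i ≈ a (toℕ i)) →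
    (∀ k j → j Fin.< k → U k j ≈ 0#) → (∀ j → U j j ≈ d (toℕ j)) →
    ∣ (λ i j → sum λ k → A i k * U k j) ∣ ≈ product {n} λ i → a (toℕ i) * d (toℕ i)
  det-triangular-product {n} A U a d lower diagA upper diagU = begin
    ∣ (λ i j → sum λ k → A i k * U k j) ∣                 ≈⟨ det-*-upper A U d upper diagU ⟩
    ∣ A ∣ * product {n} (d ∘ toℕ)                         ≈⟨ *-congʳ (det-lower A a lower diagA) ⟩
    product {n} (a ∘ toℕ) * product {n} (d ∘ toℕ)         ≈⟨ product-distrib-* {n} (a ∘ toℕ) (d ∘ toℕ) ⟨
    product {n} (λ i → a (toℕ i) * d (toℕ i))             ∎

  det-scale-rows : ∀ {n} (M : Matrix n) (r : ℕ → Carrier) →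
    ∣ (λ i j → r (toℕ i) * M i j) ∣ ≈ product {n} (r ∘ toℕ) * ∣ M ∣
  det-scale-rows {zero}  M r = sym (*-identityˡ 1#)
  det-scale-rows {suc n} M r = begin
    (sum λ j → sign (toℕ j) * (r 0 * M zero j) * ∣ (λ i k → r (suc (toℕ i)) * minor M j i k) ∣)
      ≈⟨ sum-cong-≋ {suc n} {y = λ j → product {suc n} (r ∘ toℕ) * term M j} (λ j → trans
           (*-congˡ (det-scale-rows (minor M j) (r ∘ suc)))
           (solve 5 (λ s x m y z → (s :* (x :* m)) :* (y :* z) := (x :* y) :* ((s :* m) :* z)) refl
              (sign (toℕ j)) (r 0) (M zero j) (product {n} (r ∘ suc ∘ toℕ)) ∣ minor M j ∣)) ⟩
    (sum λ j → product {suc n} (r ∘ toℕ) * term M j)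
      ≈⟨ *-distribˡ-sum _ (term M) ⟨
    product {suc n} (r ∘ toℕ) * sum (term M) ∎

  -- Only column 1 contributes to the expansion along the first row, and its minor has the same
  -- shape. The surviving permutation is an (n + 1)-cycle, whence the sign.
  det-cyclic : ∀ {n} (M : Matrix (suc n)) →
    (∀ i → toℕ i ℕ.< n → M i zero ≈ 0#) →
    (∀ i k → toℕ i ≡ toℕ k → M i (suc k) ≈ 1#) →
    (∀ i k → toℕ i ℕ.< toℕ k → M i (suc k) ≈ 0#) →
    ∣ M ∣ ≈ sign n * M (fromℕ n) zero
  det-cyclic {zero}  M _ _ _ = trans (+-identityʳ _) (*-identityʳ _)
  det-cyclic {suc n} M column diagonal upper = begin
    sum (term M)
      ≈⟨ sum-single (term M) (suc zero) off ⟩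
    - 1# * 1# * M zero (suc zero) * ∣ minor M (suc zero) ∣
      ≈⟨ *-cong (*-cong (*-identityʳ _) (diagonal zero zero ≡.refl))
           (det-cyclic (minor M (suc zero))
             (λ i i<n → column (suc i) (ℕ.s≤s i<n))
             (λ i k i≡k → diagonal (suc i) (suc k) (≡.cong suc i≡k))
             (λ i k i<k → upper (suc i) (suc k) (ℕ.s≤s i<k))) ⟩
    - 1# * 1# * (sign n * M (fromℕ (suc n)) zero)
      ≈⟨ trans (*-congʳ (*-identityʳ _)) (sym (*-assoc _ _ _)) ⟩
    sign (suc n) * M (fromℕ (suc n)) zero ∎
    where
    vanish : ∀ j → M zero j ≈ 0# → term M j ≈ 0#
    vanish j e = trans (*-congʳ (trans (*-congˡ e) (zeroʳ _))) (zeroˡ _)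
    off : ∀ j → j ≢ suc zero → term M j ≈ 0#
    off zero          _   = vanish zero (column zero ℕ.z<s)
    off (suc zero)    j≢1 = contradiction ≡.refl j≢1
    off (suc (suc j)) _   = vanish (suc (suc j)) (upper zero (suc j) ℕ.z<s)

-- Stieltjes continued fractions

-- Row i of even i (resp. odd i) counts Dyck paths of length 2i (resp. 2i + 1) by
-- final height 2k (resp. 2k + 1), a down step to height 2k (resp. 2k + 1) having
-- weight a k (resp. b k); thus even i 0 is the i-th moment of the Stieltjes
-- continued fraction with coefficients a 0, b 0, a 1, b 1, ….

module DyckPaths {c ℓ} (R : CommutativeRing c ℓ)
                 (a b : ℕ → CommutativeRing.Carrier R) where
  open CommutativeRing R hiding (zero)
  open import Algebra.Properties.Semiring.Sum semiring
  open import Algebra.Solver.Ring.NaturalCoefficients.Default commutativeSemiring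
    using (solve; _:=_; _:+_; _:*_; con)
  open import Relation.Binary.Reasoning.Setoid setoid

  even odd : ℕ → ℕ → Carrier
  even zero    zero    = 1#
  even zero    (suc k) = 0#
  even (suc i) zero    = a 0 * odd i 0
  even (suc i) (suc k) = odd i k + a (suc k) * odd i (suc k)
  odd i k = even i k + b k * even i (suc k)

  moment : ℕ → Carrier
  moment i = even i 0

  -- The weights of the straight descents from the heights 2k and 2k + 1 to 0. Equivalently, the
  -- squared norms of the associated orthogonal polynomials.
  evenNorm oddNorm : ℕ → Carrier
  evenNorm zero    = 1#
  evenNorm (suc k) = b k * oddNorm k
  oddNorm k = a k * evenNorm k

  even-above : ∀ i k → i ℕ.< k → even i k ≈ 0#
  odd-above  : ∀ i k → i ℕ.< k → odd i k ≈ 0#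
  even-above zero    (suc k) _   = refl
  even-above (suc i) (suc k) i<k = trans
    (+-cong (odd-above i k (ℕ.s<s⁻¹ i<k)) (*-congˡ (odd-above i (suc k) (ℕ.<-trans (ℕ.n<1+n i) i<k))))
    (solve 1 (λ x → con 0 :+ x :* con 0 := con 0) refl (a (suc k)))
  odd-above i k i<k = trans
    (+-cong (even-above i k i<k) (*-congˡ (even-above i (suc k) (ℕ.m<n⇒m<1+n i<k))))
    (solve 1 (λ x → con 0 :+ x :* con 0 := con 0) refl (b k))

  even-diagonal : ∀ i → even i i ≈ 1#
  odd-diagonal  : ∀ i → odd i i ≈ 1#
  even-diagonal zero    = refl
  even-diagonal (suc i) = trans
    (+-cong (odd-diagonal i) (*-congˡ (odd-above i (suc i) (ℕ.n<1+n i))))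
    (solve 1 (λ x → con 1 :+ x :* con 0 := con 1) refl (a (suc i)))
  odd-diagonal i = trans
    (+-cong (even-diagonal i) (*-congˡ (even-above i (suc i) (ℕ.n<1+n i))))
    (solve 1 (λ x → con 1 :+ x :* con 0 := con 1) refl (b i))

  -- Paths from 0 to 0 cut at a given time, sorted by the height of the cut. The second half is read
  -- backwards; reversal turns its up steps into down steps, and the norm accounts for the change of
  -- weight. N bounds the heights.
  even-sum odd-sum : ℕ → ℕ → ℕ → Carrier
  even-sum N i j = sum {N} λ k → even i (toℕ k) * evenNorm (toℕ k) * even j (toℕ k)
  odd-sum  N i j = sum {N} λ k → odd  i (toℕ k) * oddNorm  (toℕ k) * odd  j (toℕ k)

  -- The paths whose step at the cut leads from height 2N - 1 up to 2N: `odd-sum N` sees them,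
  -- `even-sum N` stops just below 2N.
  boundary : ℕ → ℕ → ℕ → Carrier
  boundary zero    i j = 0#
  boundary (suc N) i j = odd i N * evenNorm (suc N) * even j (suc N)

  -- Both sides count paths of length 2(i + j + 1); the cut moves from time 2i + 1 to time 2i + 2.
  -- In algebraic terms, a step is self-adjoint with respect to the norms up to the truncation.
  summation-by-parts : ∀ N i j → odd-sum N i j ≈ even-sum N (suc i) j + boundary N i j
  summation-by-parts zero    i j = sym (+-identityʳ 0#)
  summation-by-parts (suc N) i j = begin
    odd-sum (suc N) i j
      ≈⟨ sum-toℕ-last +-monoid (λ k → odd i k * oddNorm k * odd j k) N ⟩
    odd-sum N i j + odd i N * oddNorm N * odd j N
      ≈⟨ +-congʳ (summation-by-parts N i j) ⟩
    even-sum N (suc i) j + boundary N i j + odd i N * oddNorm N * odd j N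
      ≈⟨ step N ⟩
    even-sum N (suc i) j + even (suc i) N * evenNorm N * even j N + boundary (suc N) i j
      ≈⟨ +-congʳ (sum-toℕ-last +-monoid (λ k → even (suc i) k * evenNorm k * even j k) N) ⟨
    even-sum (suc N) (suc i) j + boundary (suc N) i j ∎
    where
    step : ∀ N → even-sum N (suc i) j + boundary N i j + odd i N * oddNorm N * odd j N
               ≈ even-sum N (suc i) j + even (suc i) N * evenNorm N * even j N + boundary (suc N) i j
    step zero    = solve 6 (λ s o α β x y →
        s :+ con 0 :+ o :* (α :* con 1) :* (x :+ β :* y)
          := s :+ α :* o :* con 1 :* x :+ o :* (β :* (α :* con 1)) :* y)
      refl (even-sum 0 (suc i) j) (odd i 0) (a 0) (b 0) (even j 0) (even j 1)
    step (suc N) = solve 8 (λ s o o′ h α β x y →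
        s :+ o :* h :* x :+ o′ :* (α :* h) :* (x :+ β :* y)
          := s :+ (o :+ α :* o′) :* h :* x :+ o′ :* (β :* (α :* h)) :* y)
      refl (even-sum (suc N) (suc i) j) (odd i N) (odd i (suc N)) (evenNorm (suc N))
        (a (suc N)) (b (suc N)) (even j (suc N)) (even j (suc (suc N)))

  even-sum-suc : ∀ N i j → boundary N i j ≈ 0# → even-sum N (suc i) j ≈ odd-sum N i j
  even-sum-suc N i j b≈0 = begin
    even-sum N (suc i) j                   ≈⟨ +-identityʳ _ ⟨
    even-sum N (suc i) j + 0#              ≈⟨ +-congˡ b≈0 ⟨
    even-sum N (suc i) j + boundary N i j  ≈⟨ summation-by-parts N i j ⟨
    odd-sum N i j                          ∎

  even-sum-comm : ∀ N i j → even-sum N i j ≈ even-sum N j i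
  even-sum-comm N i j = sum-cong-≋ {N} λ k →
    solve 3 (λ x h y → x :* h :* y := y :* h :* x) refl (even i (toℕ k)) (evenNorm (toℕ k)) (even j (toℕ k))

  odd-sum-comm : ∀ N i j → odd-sum N i j ≈ odd-sum N j i
  odd-sum-comm N i j = sum-cong-≋ {N} λ k →
    solve 3 (λ x h y → x :* h :* y := y :* h :* x) refl (odd i (toℕ k)) (oddNorm (toℕ k)) (odd j (toℕ k))

  -- The same move of the cut, read from the other end of the path. The bound on i ensures that the
  -- first half is too short to reach the boundary.
  odd-sum-even-sum : ∀ N i j → i ℕ.< N → odd-sum N i j ≈ even-sum N i (suc j)
  odd-sum-even-sum (suc N) i j i<N = begin
    odd-sum (suc N) i j         ≈⟨ odd-sum-comm (suc N) i j ⟩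
    odd-sum (suc N) j i         ≈⟨ even-sum-suc (suc N) j i (trans (*-congˡ (even-above i (suc N) i<N)) (zeroʳ _)) ⟨
    even-sum (suc N) (suc j) i  ≈⟨ even-sum-comm (suc N) (suc j) i ⟩
    even-sum (suc N) i (suc j)  ∎

  -- The cut moves back two steps at a time until it reaches time 0, where the height can only be 0.
  -- Over all i, j below N this is the factorization of the Hankel matrix into lower triangular,
  -- diagonal and upper triangular.
  even-sum-moment : ∀ N i j → i ℕ.< N → even-sum N i j ≈ moment (i ℕ.+ j)
  even-sum-moment (suc N) zero    j _   = begin
    1# * 1# * even j 0 + sum {N} (λ k → 0# * evenNorm (suc (toℕ k)) * even j (suc (toℕ k)))
      ≈⟨ +-cong (trans (*-congʳ (*-identityˡ 1#)) (*-identityˡ _))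
           (trans (sum-cong-≋ {N} {y = λ _ → 0#} (λ k → trans (*-congʳ (zeroˡ _)) (zeroˡ _))) (sum-replicate-zero N)) ⟩
    even j 0 + 0#
      ≈⟨ +-identityʳ _ ⟩
    moment j ∎
  even-sum-moment (suc N) (suc i) j i<N = begin
    even-sum (suc N) (suc i) j
      ≈⟨ even-sum-suc (suc N) i j (trans (*-congʳ (trans (*-congʳ (odd-above i N (ℕ.s<s⁻¹ i<N))) (zeroˡ _))) (zeroˡ _)) ⟩
    odd-sum (suc N) i j
      ≈⟨ odd-sum-even-sum (suc N) i j i<1+N ⟩
    even-sum (suc N) i (suc j)
      ≈⟨ even-sum-moment (suc N) i (suc j) i<1+N ⟩
    moment (i ℕ.+ suc j)
      ≈⟨ reflexive (≡.cong moment (ℕ.+-suc i j)) ⟩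
    moment (suc i ℕ.+ j) ∎
    where i<1+N = ℕ.<-trans (ℕ.n<1+n i) i<N

  odd-sum-moment : ∀ N i j → i ℕ.< N → odd-sum N i j ≈ moment (suc (i ℕ.+ j))
  odd-sum-moment N i j i<N = begin
    odd-sum N i j           ≈⟨ odd-sum-even-sum N i j i<N ⟩
    even-sum N i (suc j)    ≈⟨ even-sum-moment N i (suc j) i<N ⟩
    moment (i ℕ.+ suc j)    ≈⟨ reflexive (≡.cong moment (ℕ.+-suc i j)) ⟩
    moment (suc (i ℕ.+ j))  ∎

  cauchy : (u v : ℕ → Carrier) → ℕ → Carrier
  cauchy u v m = sum {suc m} λ k → u (toℕ k) * v (m ∸ toℕ k)

  cauchy-cong : ∀ {u u′} v → (∀ k → u k ≈ u′ k) → ∀ m → cauchy u v m ≈ cauchy u′ v m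
  cauchy-cong v u≈ m = sum-cong-≋ {suc m} λ k → *-congʳ {v (m ∸ toℕ k)} (u≈ (toℕ k))

  cauchy-+ : ∀ u u′ v m → cauchy (λ k → u k + u′ k) v m ≈ cauchy u v m + cauchy u′ v m
  cauchy-+ u u′ v m = trans
    (sum-cong-≋ {suc m} λ k → distribʳ (v (m ∸ toℕ k)) (u (toℕ k)) (u′ (toℕ k)))
    (∑-distrib-+ {suc m} (λ k → u (toℕ k) * v (m ∸ toℕ k)) (λ k → u′ (toℕ k) * v (m ∸ toℕ k)))

  cauchy-* : ∀ x u v m → cauchy (λ k → x * u k) v m ≈ x * cauchy u v m
  cauchy-* x u v m = trans
    (sum-cong-≋ {suc m} λ k → *-assoc x (u (toℕ k)) (v (m ∸ toℕ k)))
    (sym (*-distribˡ-sum {suc m} x (λ k → u (toℕ k) * v (m ∸ toℕ k))))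

  -- The paths that stay above height 0 are then scaled copies of those counted by odd, so
  -- cutting an arbitrary path at its last visit to 0 yields a convolution.
  module SelfSimilar (P : Carrier)
    (level  : ∀ k → b k + a (suc k) ≈ P * (a k + b k))
    (return : ∀ k → a (suc k) * b (suc k) ≈ P * P * (b k * a (suc k))) where
    open import Algebra.Definitions.RawSemiring (Semiring.rawSemiring semiring) using (_^_)

    scaled : ℕ → ℕ → Carrier
    scaled k i = P ^ i * odd i k

    scaled-suc-zero : ∀ i → scaled 0 (suc i) ≈ P * (a 0 + b 0) * scaled 0 i + P * (b 0 * a 1) * scaled 1 i
    scaled-suc-zero i = solve 7 (λ P Pⁱ α β α′ x y →
        P :* Pⁱ :* (α :* x :+ β :* (x :+ α′ :* y))
          := P :* (α :+ β) :* (Pⁱ :* x) :+ P :* (β :* α′) :* (Pⁱ :* y))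
      refl P (P ^ i) (a 0) (b 0) (a 1) (odd i 0) (odd i 1)

    scaled-suc-suc : ∀ k i → scaled (suc k) (suc i) ≈
      P * scaled k i + (P * (a (suc k) + b (suc k)) * scaled (suc k) i
                         + P * (b (suc k) * a (suc (suc k))) * scaled (suc (suc k)) i)
    scaled-suc-suc k i = solve 8 (λ P Pⁱ α β α′ w x y →
        P :* Pⁱ :* ((w :+ α :* x) :+ β :* (x :+ α′ :* y))
          := P :* (Pⁱ :* w) :+ (P :* (α :+ β) :* (Pⁱ :* x) :+ P :* (β :* α′) :* (Pⁱ :* y)))
      refl P (P ^ i) (a (suc k)) (b (suc k)) (a (suc (suc k))) (odd i k) (odd i (suc k)) (odd i (suc (suc k)))

    scaled-zero : ∀ k → scaled (suc k) 0 ≈ 0#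
    scaled-zero k = trans (*-congˡ (odd-above 0 (suc k) ℕ.z<s)) (zeroʳ 1#)

    -- Two steps at even heights: the level weight b k + a (k + 1) and the return weight a (k + 1) *
    -- b (k + 1) are traded for multiples of those at odd heights.
    even-suc-suc : ∀ m k → even (suc (suc m)) (suc k) ≈
      even (suc m) k + (P * (a k + b k) * even (suc m) (suc k)
                         + P * P * (b k * a (suc k)) * even (suc m) (suc (suc k)))
    even-suc-suc m k = trans
      (solve 6 (λ x y z β α′ β′ →
          (x :+ β :* y) :+ α′ :* (y :+ β′ :* z) := x :+ ((β :+ α′) :* y :+ α′ :* β′ :* z))
        refl (even (suc m) k) (even (suc m) (suc k)) (even (suc m) (suc (suc k)))
          (b k) (a (suc k)) (b (suc k)))
      (+-congˡ (+-cong (*-congʳ (level k)) (*-congʳ (return k))))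

    cauchy-linear : ∀ u x v y w m → (∀ i → u (suc i) ≈ x * v i + y * w i) →
      cauchy u moment (suc m) ≈ u 0 * moment (suc m) + (x * cauchy v moment m + y * cauchy w moment m)
    cauchy-linear u x v y w m u≈ = +-congˡ (trans (cauchy-cong moment u≈ m)
      (trans (cauchy-+ (λ i → x * v i) (λ i → y * w i) moment m)
        (+-cong (cauchy-* x v moment m) (cauchy-* y w moment m))))

    -- After the last visit to 0 comes a double step up, and then i double steps from height 2 to 2k
    -- + 2 that avoid 0. A level step there costs one P more than at odd heights, a double descent
    -- two and a double ascent none, which makes P to the power i - k; the factor `P ^ k` on the
    -- left keeps the exponent nonnegative. Formally both sides satisfy the same recurrence in m.
    last-visit : ∀ m k → P ^ k * even (suc m) (suc k) ≈ cauchy (scaled k) moment m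
    last-visit zero zero = begin
      1# * (odd 0 0 + a 1 * odd 0 1)  ≈⟨ *-congˡ (+-congˡ (*-congˡ (odd-above 0 1 ℕ.z<s))) ⟩
      1# * (odd 0 0 + a 1 * 0#)
        ≈⟨ solve 2 (λ x y → con 1 :* (x :+ y :* con 0) := con 1 :* x :* con 1 :+ con 0) refl (odd 0 0) (a 1) ⟩
      1# * odd 0 0 * 1# + 0#          ∎
    last-visit zero (suc k) = begin
      P ^ suc k * (odd 0 (suc k) + a (suc (suc k)) * odd 0 (suc (suc k)))
        ≈⟨ *-congˡ (+-cong (odd-above 0 (suc k) ℕ.z<s) (*-congˡ (odd-above 0 (suc (suc k)) ℕ.z<s))) ⟩
      P ^ suc k * (0# + a (suc (suc k)) * 0#)
        ≈⟨ solve 2 (λ x y → x :* (con 0 :+ y :* con 0) := con 0 :* con 1 :+ con 0) refl (P ^ suc k) (a (suc (suc k))) ⟩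
      0# * 1# + 0#
        ≈⟨ +-congʳ (*-congʳ (scaled-zero k)) ⟨
      scaled (suc k) 0 * 1# + 0# ∎
    last-visit (suc m) zero = begin
      1# * even (suc (suc m)) 1
        ≈⟨ *-congˡ (even-suc-suc m 0) ⟩
      1# * (E 0 + (P * μ * E 1 + P * P * ν * E 2))
        ≈⟨ solve 6 (λ P μ ν x y z →
             con 1 :* (x :+ (P :* μ :* y :+ P :* P :* ν :* z))
               := con 1 :* x :+ (P :* μ :* (con 1 :* y) :+ P :* ν :* (P :* con 1 :* z)))
             refl P μ ν (E 0) (E 1) (E 2) ⟩
      1# * E 0 + (P * μ * (1# * E 1) + P * ν * (P * 1# * E 2))
        ≈⟨ +-cong (*-congʳ (sym (trans (*-identityˡ _) (odd-diagonal 0))))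
             (+-cong (*-congˡ (last-visit m 0)) (*-congˡ (last-visit m 1))) ⟩
      scaled 0 0 * E 0 + (P * μ * cauchy (scaled 0) moment m + P * ν * cauchy (scaled 1) moment m)
        ≈⟨ cauchy-linear (scaled 0) (P * μ) (scaled 0) (P * ν) (scaled 1) m scaled-suc-zero ⟨
      cauchy (scaled 0) moment (suc m) ∎
      where
      E : ℕ → Carrier
      E = even (suc m)
      μ ν : Carrier
      μ = a 0 + b 0
      ν = b 0 * a 1
    last-visit (suc m) (suc k) = begin
      P ^ suc k * even (suc (suc m)) (suc (suc k))
        ≈⟨ *-congˡ (even-suc-suc m (suc k)) ⟩
      P ^ suc k * (E 0 + (P * μ * E 1 + P * P * ν * E 2))
        ≈⟨ solve 7 (λ P Pᵏ μ ν x y z →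
             P :* Pᵏ :* (x :+ (P :* μ :* y :+ P :* P :* ν :* z))
               := con 0 :+ (P :* (Pᵏ :* x) :+ con 1 :* (P :* μ :* (P :* Pᵏ :* y) :+ P :* ν :* (P :* (P :* Pᵏ) :* z))))
             refl P (P ^ k) μ ν (E 0) (E 1) (E 2) ⟩
      0# + (P * (P ^ k * E 0) + 1# * (P * μ * (P ^ suc k * E 1) + P * ν * (P ^ suc (suc k) * E 2)))
        ≈⟨ +-cong (sym (trans (*-congʳ (scaled-zero k)) (zeroˡ _)))
             (+-cong (*-congˡ (last-visit m k)) (*-congˡ
               (+-cong (*-congˡ (last-visit m (suc k))) (*-congˡ (last-visit m (suc (suc k))))))) ⟩
      scaled (suc k) 0 * moment (suc m) + (P * C k + 1# * (P * μ * C (suc k) + P * ν * C (suc (suc k))))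
        ≈⟨ +-congˡ (+-congˡ (*-congˡ (trans (cauchy-+ (λ i → P * μ * scaled (suc k) i) (λ i → P * ν * scaled (suc (suc k)) i) moment m)
             (+-cong (cauchy-* (P * μ) (scaled (suc k)) moment m) (cauchy-* (P * ν) (scaled (suc (suc k))) moment m))))) ⟨
      scaled (suc k) 0 * moment (suc m) + (P * C k + 1# * cauchy rest moment m)
        ≈⟨ cauchy-linear (scaled (suc k)) P (scaled k) 1# rest m
             (λ i → trans (scaled-suc-suc k i) (+-congˡ (sym (*-identityˡ _)))) ⟨
      cauchy (scaled (suc k)) moment (suc m) ∎
      where
      E C : ℕ → Carrier
      E j = even (suc m) (j ℕ.+ suc k)
      C j = cauchy (scaled j) moment m
      μ ν : Carrier
      μ = a (suc k) + b (suc k)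
      ν = b (suc k) * a (suc (suc k))
      rest : ℕ → Carrier
      rest i = P * μ * scaled (suc k) i + P * ν * scaled (suc (suc k)) i

    -- `last-visit` at k = 0. The factor a 0 of the final descent moves into the convolution, where
    -- `a 0 * odd k 0` is `moment (suc k)`.
    moment-suc-suc : ∀ m → moment (suc (suc m)) ≈
      a 0 * moment (suc m) + b 0 * cauchy (λ k → P ^ k * moment (suc k)) moment m
    moment-suc-suc m = begin
      a 0 * (moment (suc m) + b 0 * even (suc m) 1)
        ≈⟨ *-congˡ (+-congˡ (*-congˡ (trans (sym (*-identityˡ _)) (last-visit m 0)))) ⟩
      a 0 * (moment (suc m) + b 0 * cauchy (scaled 0) moment m)
        ≈⟨ solve 4 (λ α β x y → α :* (x :+ β :* y) := α :* x :+ β :* (α :* y)) refl _ _ _ _ ⟩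
      a 0 * moment (suc m) + b 0 * (a 0 * cauchy (scaled 0) moment m)
        ≈⟨ +-congˡ (*-congˡ (cauchy-* (a 0) (scaled 0) moment m)) ⟨
      a 0 * moment (suc m) + b 0 * cauchy (λ k → a 0 * scaled 0 k) moment m
        ≈⟨ +-congˡ (*-congˡ (cauchy-cong moment (λ k →
             solve 3 (λ α x y → α :* (x :* y) := x :* (α :* y)) refl (a 0) (P ^ k) (odd k 0)) m)) ⟩
      a 0 * moment (suc m) + b 0 * cauchy (λ k → P ^ k * moment (suc k)) moment m ∎

-- Hankel determinants

exponent-≤ : ∀ i d → exponent i (i ℕ.+ d) ≡ d ℕ.* suc d
exponent-≤ i d = ≡.cong ℤ.∣_∣ (≡.trans (identity (+ i) (+ d)) (≡.sym (ℤ.pos-* d (suc d))))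
  where
  identity : ∀ x y → (x ℤ.- (x ℤ.+ y)) ℤ.* (x ℤ.- (x ℤ.+ y) ℤ.- 1ℤ) ≡ y ℤ.* (1ℤ ℤ.+ y)
  identity = ℤSolver.solve-∀

exponent-> : ∀ j d → exponent (suc d ℕ.+ j) j ≡ suc d ℕ.* d
exponent-> j d = ≡.cong ℤ.∣_∣ (≡.trans (identity (+ j) (+ d)) (≡.sym (ℤ.pos-* (suc d) d)))
  where
  identity : ∀ x y → (1ℤ ℤ.+ y ℤ.+ x ℤ.- x) ℤ.* (1ℤ ℤ.+ y ℤ.+ x ℤ.- x ℤ.- 1ℤ) ≡ (1ℤ ℤ.+ y) ℤ.* y
  identity = ℤSolver.solve-∀

-- The mixed term -2ij of (i - j)(i - j - 1) cancels against that of (i + j + t)², the exponent that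
-- comes with S_(i+j+t). Hence the power of q is a row factor times a column factor.
rowExponent columnExponent : ℕ → ℕ → ℕ
rowExponent    t i = 2 ℕ.* (i ℕ.* i) ℕ.+ 2 ℕ.* t ℕ.* i ℕ.+ t ℕ.* t
columnExponent t j = 2 ℕ.* (j ℕ.* j) ℕ.+ j ℕ.+ 2 ℕ.* t ℕ.* j

-- For t = 0 this is (i − j)(i − j − 1) + (i + j)² = 2i² − i + 2j² + j, with i moved to the
-- left-hand side to stay in ℕ.
ExponentSplits : ℕ → ℕ → ℕ → Set
ExponentSplits t i j = exponent i j ℕ.+ (i ℕ.+ j ℕ.+ t) ℕ.* (i ℕ.+ j ℕ.+ t) ℕ.+ i
                     ≡ rowExponent t i ℕ.+ columnExponent t j

exponent-splits : ∀ t i j → ExponentSplits t i j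
exponent-splits t i j with ℕ.≤-<-connex i j
... | inj₁ i≤j = ≡.subst (λ j → ExponentSplits t i j) (ℕ.m+[n∸m]≡n i≤j) (below (j ∸ i))
  where
  identity : ∀ t i d → d ℕ.* suc d ℕ.+ (i ℕ.+ (i ℕ.+ d) ℕ.+ t) ℕ.* (i ℕ.+ (i ℕ.+ d) ℕ.+ t) ℕ.+ i
    ≡ 2 ℕ.* (i ℕ.* i) ℕ.+ 2 ℕ.* t ℕ.* i ℕ.+ t ℕ.* t ℕ.+ (2 ℕ.* ((i ℕ.+ d) ℕ.* (i ℕ.+ d)) ℕ.+ (i ℕ.+ d) ℕ.+ 2 ℕ.* t ℕ.* (i ℕ.+ d))
  identity = ℕSolver.solve-∀
  below : ∀ d → ExponentSplits t i (i ℕ.+ d)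
  below d rewrite exponent-≤ i d = identity t i d
... | inj₂ j<i = ≡.subst (λ i → ExponentSplits t i j)
        (≡.trans (≡.sym (ℕ.+-suc (i ∸ suc j) j)) (ℕ.m∸n+n≡m j<i)) (above (i ∸ suc j))
  where
  identity : ∀ t j d → suc d ℕ.* d ℕ.+ (suc d ℕ.+ j ℕ.+ j ℕ.+ t) ℕ.* (suc d ℕ.+ j ℕ.+ j ℕ.+ t) ℕ.+ (suc d ℕ.+ j)
    ≡ 2 ℕ.* ((suc d ℕ.+ j) ℕ.* (suc d ℕ.+ j)) ℕ.+ 2 ℕ.* t ℕ.* (suc d ℕ.+ j) ℕ.+ t ℕ.* t ℕ.+ (2 ℕ.* (j ℕ.* j) ℕ.+ j ℕ.+ 2 ℕ.* t ℕ.* j)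
  identity = ℕSolver.solve-∀
  above : ∀ d → ExponentSplits t (suc d ℕ.+ j) j
  above d rewrite exponent-> j d = identity t j d

module HankelDeterminants {c ℓ} (R : CommutativeRing c ℓ)
                          (a b : ℕ → CommutativeRing.Carrier R) where
  open CommutativeRing R hiding (zero)
  open import Algebra.Definitions.RawSemiring (Semiring.rawSemiring semiring) using (product)
  open import Algebra.Properties.CommutativeMonoid.Sum *-commutativeMonoid using ()
    renaming (∑-distrib-+ to product-distrib-*)
  open import Algebra.Properties.Ring ring using (-1*x≈-x; +-cancelʳ)
  open import Algebra.Properties.Semiring.Sum semiring using (sum; sum-cong-≋; *-distribˡ-sum)
  open import Algebra.Solver.Ring.NaturalCoefficients.Default commutativeSemiring
    using (solve; _:=_; _:+_; _:*_; con)
  open import Relation.Binary.Reasoning.Setoid setoid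
  open Determinant R
  open DyckPaths R a b

  factor-sum : ∀ {n} x y (f h g : ℕ → Carrier) →
    x * y * (sum {n} λ k → f (toℕ k) * h (toℕ k) * g (toℕ k))
      ≈ sum {n} λ k → x * f (toℕ k) * (h (toℕ k) * (y * g (toℕ k)))
  factor-sum {n} x y f h g = trans
    (*-distribˡ-sum {n} (x * y) (λ k → f (toℕ k) * h (toℕ k) * g (toℕ k)))
    (sum-cong-≋ {n} λ k →
      solve 5 (λ x y f h g → x :* y :* (f :* h :* g) := x :* f :* (h :* (y :* g))) refl
        x y (f (toℕ k)) (h (toℕ k)) (g (toℕ k)))

  *-zero₃ : ∀ h y {z} → z ≈ 0# → h * (y * z) ≈ 0#
  *-zero₃ h y z≈0 = trans (*-congˡ (trans (*-congˡ z≈0) (zeroʳ y))) (zeroʳ h)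

  -- `even-sum-moment` as a matrix product. The row and column factors, later the powers of q, are
  -- absorbed into the two triangular matrices and appear on their diagonals.
  hankel₀ : ∀ n (r s : ℕ → Carrier) →
    ∣ (λ (i j : Fin n) → r (toℕ i) * s (toℕ j) * moment (toℕ i ℕ.+ toℕ j)) ∣
      ≈ product {n} λ i → r (toℕ i) * (evenNorm (toℕ i) * s (toℕ i))
  hankel₀ n r s = trans
    (det-cong λ i j → trans
      (*-congˡ (sym (even-sum-moment n (toℕ i) (toℕ j) (Fin.toℕ<n i))))
      (factor-sum {n} (r (toℕ i)) (s (toℕ j)) (even (toℕ i)) evenNorm (even (toℕ j))))
    (det-triangular-product {n} (λ i k → r (toℕ i) * even (toℕ i) (toℕ k))
      (λ k j → evenNorm (toℕ k) * (s (toℕ j) * even (toℕ j) (toℕ k))) r (λ k → evenNorm k * s k)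
      (λ i k i<k → trans (*-congˡ (even-above (toℕ i) (toℕ k) i<k)) (zeroʳ _))
      (λ i → trans (*-congˡ (even-diagonal (toℕ i))) (*-identityʳ _))
      (λ k j j<k → *-zero₃ _ _ (even-above (toℕ j) (toℕ k) j<k))
      (λ j → *-congˡ (trans (*-congˡ (even-diagonal (toℕ j))) (*-identityʳ _))))

  hankel₁ : ∀ n (r s : ℕ → Carrier) →
    ∣ (λ (i j : Fin n) → r (toℕ i) * s (toℕ j) * moment (suc (toℕ i ℕ.+ toℕ j))) ∣
      ≈ product {n} λ i → r (toℕ i) * (oddNorm (toℕ i) * s (toℕ i))
  hankel₁ n r s = trans
    (det-cong λ i j → trans
      (*-congˡ (sym (odd-sum-moment n (toℕ i) (toℕ j) (Fin.toℕ<n i))))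
      (factor-sum {n} (r (toℕ i)) (s (toℕ j)) (odd (toℕ i)) oddNorm (odd (toℕ j))))
    (det-triangular-product {n} (λ i k → r (toℕ i) * odd (toℕ i) (toℕ k))
      (λ k j → oddNorm (toℕ k) * (s (toℕ j) * odd (toℕ j) (toℕ k))) r (λ k → oddNorm k * s k)
      (λ i k i<k → trans (*-congˡ (odd-above (toℕ i) (toℕ k) i<k)) (zeroʳ _))
      (λ i → trans (*-congˡ (odd-diagonal (toℕ i))) (*-identityʳ _))
      (λ k j j<k → *-zero₃ _ _ (odd-above (toℕ j) (toℕ k) j<k))
      (λ j → *-congˡ (trans (*-congˡ (odd-diagonal (toℕ j))) (*-identityʳ _))))

  -- The determinant of the n × n truncation of the Jacobi matrix with diagonal
  -- entries a k + b k and off-diagonal products b k * a (k + 1).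
  continuant : ℕ → Carrier
  continuant zero    = 1#
  continuant (suc n) = b n * continuant n + product {suc n} (a ∘ toℕ)

  continuant-suc-suc : ∀ n → continuant (suc (suc n)) + b n * a (suc n) * continuant n
                           ≈ (a (suc n) + b (suc n)) * continuant (suc n)
  continuant-suc-suc n = trans
    (+-congʳ (+-congˡ (sum-toℕ-last *-monoid a (suc n))))
    (solve 5 (λ α β β′ C Π →
        β′ :* (β :* C :+ Π) :+ Π :* α :+ β :* α :* C := (α :+ β′) :* (β :* C :+ Π))
      refl (a (suc n)) (b n) (b (suc n)) (continuant n) (product {suc n} (a ∘ toℕ)))

  -- The Jacobi matrix maps this vector to 0, so combining the columns of the shifted
  -- factor with these coefficients clears the first column up to its last entry.
  signed : ℕ → Carrier
  signed k = sign k * continuant k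

  signed-one : (a 0 + b 0) * signed 0 + signed 1 ≈ 0#
  signed-one = trans
    (solve 3 (λ α β m → (α :+ β) :* (con 1 :* con 1) :+ m :* con 1 :* (β :* con 1 :+ α :* con 1)
      := (α :+ β) :+ m :* (α :+ β)) refl (a 0) (b 0) (- 1#))
    (x+-1*x≈0 _)

  signed-suc-suc : ∀ n → b n * a (suc n) * signed n + (a (suc n) + b (suc n)) * signed (suc n) + signed (suc (suc n)) ≈ 0#
  signed-suc-suc n = begin
    b n * a (suc n) * signed n + (a (suc n) + b (suc n)) * signed (suc n) + signed (suc (suc n))
      ≈⟨ +-congʳ (+-congˡ (trans (solve 4 (λ x m s C → x :* (m :* s :* C) := m :* s :* (x :* C)) refl _ _ _ _)
           (*-congˡ (sym (continuant-suc-suc n))))) ⟩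
    b n * a (suc n) * signed n + - 1# * sign n * (C₂ + b n * a (suc n) * continuant n) + signed (suc (suc n))
      ≈⟨ solve 5 (λ x m s C C₂ → x :* (s :* C) :+ m :* s :* (C₂ :+ x :* C) :+ m :* (m :* s) :* C₂
           := s :* (x :* C) :+ m :* (s :* (x :* C)) :+ (m :* s :* C₂ :+ m :* (m :* s :* C₂)))
           refl (b n * a (suc n)) (- 1#) (sign n) (continuant n) C₂ ⟩
    sign n * (b n * a (suc n) * continuant n) + - 1# * (sign n * (b n * a (suc n) * continuant n))
      + (- 1# * sign n * C₂ + - 1# * (- 1# * sign n * C₂))
      ≈⟨ +-cong (x+-1*x≈0 _) (x+-1*x≈0 _) ⟩
    0# + 0#
      ≈⟨ +-identityʳ 0# ⟩
    0# ∎
    where C₂ = continuant (suc (suc n))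

  -- Passing from row i to row i + 1 of `odd` applies the Jacobi matrix. Shifted over to `signed`,
  -- which that matrix annihilates, it leaves only the two terms that straddle the truncation at n.
  odd-suc-combination : ∀ i n →
    sum {suc n} (λ k → odd (suc i) (toℕ k) * signed (toℕ k)) + odd i n * signed (suc n)
      ≈ odd i (suc n) * (b n * a (suc n) * signed n)
  odd-suc-combination i zero = begin
    odd (suc i) 0 * signed 0 + 0# + odd i 0 * signed 1
      ≈⟨ solve 7 (λ x y α β α′ w w′ →
           (α :* x :+ β :* (x :+ α′ :* y)) :* w :+ con 0 :+ x :* w′
             := x :* ((α :+ β) :* w :+ w′) :+ y :* (β :* α′ :* w))
           refl (odd i 0) (odd i 1) (a 0) (b 0) (a 1) (signed 0) (signed 1) ⟩
    odd i 0 * ((a 0 + b 0) * signed 0 + signed 1) + odd i 1 * (b 0 * a 1 * signed 0)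
      ≈⟨ +-congʳ (trans (*-congˡ signed-one) (zeroʳ _)) ⟩
    0# + odd i 1 * (b 0 * a 1 * signed 0)
      ≈⟨ +-identityˡ _ ⟩
    odd i 1 * (b 0 * a 1 * signed 0) ∎
  odd-suc-combination i (suc n) = begin
    sum {suc (suc n)} (λ k → odd (suc i) (toℕ k) * signed (toℕ k)) + y * signed (suc (suc n))
      ≈⟨ +-congʳ (sum-toℕ-last +-monoid (λ k → odd (suc i) k * signed k) (suc n)) ⟩
    Σ + odd (suc i) (suc n) * signed (suc n) + y * signed (suc (suc n))
      ≈⟨ solve 9 (λ Σ x y z α β α′ w w′ →
           Σ :+ ((x :+ α :* y) :+ β :* (y :+ α′ :* z)) :* w :+ y :* w′
             := (Σ :+ x :* w) :+ y :* ((α :+ β) :* w :+ w′) :+ z :* (β :* α′ :* w))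
           refl Σ x y z (a (suc n)) (b (suc n)) (a (suc (suc n))) (signed (suc n)) (signed (suc (suc n))) ⟩
    (Σ + x * signed (suc n)) + y * ((a (suc n) + b (suc n)) * signed (suc n) + signed (suc (suc n))) + last
      ≈⟨ +-congʳ (+-congʳ (odd-suc-combination i n)) ⟩
    y * (b n * a (suc n) * signed n) + y * ((a (suc n) + b (suc n)) * signed (suc n) + signed (suc (suc n))) + last
      ≈⟨ +-congʳ (trans (sym (distribˡ y _ _)) (trans (*-congˡ (trans (sym (+-assoc _ _ _)) (signed-suc-suc n))) (zeroʳ y))) ⟩
    0# + last
      ≈⟨ +-identityˡ last ⟩
    last ∎
    where
    Σ x y z last : Carrier
    Σ = sum {suc n} (λ k → odd (suc i) (toℕ k) * signed (toℕ k))
    x = odd i n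
    y = odd i (suc n)
    z = odd i (suc (suc n))
    last = z * (b (suc n) * a (suc (suc n)) * signed (suc n))

  sign-square : ∀ n → sign n * (- 1# * (- 1# * sign n)) ≈ 1#
  sign-square n = trans (*-congˡ (-1*-1*x≈x (sign n))) (square n)
    where
    -1*-1*x≈x : ∀ x → - 1# * (- 1# * x) ≈ x
    -1*-1*x≈x x = begin
      - 1# * (- 1# * x)             ≈⟨ -1*x≈-x _ ⟩
      - (- 1# * x)                  ≈⟨ -‿cong (-1*x≈-x x) ⟩
      - - x                         ≈⟨ ⁻¹-involutive x ⟩
      x                             ∎
      where open import Algebra.Properties.AbelianGroup +-abelianGroup using (⁻¹-involutive)
    square : ∀ n → sign n * sign n ≈ 1#
    square zero    = *-identityˡ 1#
    square (suc n) = begin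
      - 1# * sign n * (- 1# * sign n)   ≈⟨ solve 2 (λ m s → m :* s :* (m :* s) := m :* (m :* (s :* s))) refl _ _ ⟩
      - 1# * (- 1# * (sign n * sign n)) ≈⟨ -1*-1*x≈x _ ⟩
      sign n * sign n                   ≈⟨ square n ⟩
      1#                                ∎

  -- The shift by one row puts the unit diagonal of `odd` just above the main diagonal. Replacing
  -- the first column by the combination with weights `signed` keeps the determinant, as `signed 0`
  -- is 1, and clears that column above the corner; `det-cyclic` finishes, and its sign cancels the
  -- sign in `signed`.
  det-odd-suc : ∀ n → ∣ (λ (i k : Fin n) → odd (suc (toℕ i)) (toℕ k)) ∣ ≈ continuant n
  det-odd-suc zero    = refl
  det-odd-suc (suc n) = begin
    ∣ M ∣                                           ≈⟨ trans (*-congˡ (*-identityˡ 1#)) (*-identityʳ _) ⟨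
    ∣ M ∣ * signed 0                                ≈⟨ det-column-combination zero (signed ∘ toℕ) ([]≔-updates M zero v)
                                                         (λ i l → []≔-minimal M zero v i) ⟨
    ∣ N ∣                                           ≈⟨ det-cyclic N column diagonal upper ⟩
    sign n * v (fromℕ n)                            ≈⟨ *-congˡ corner ⟩
    sign n * (- 1# * signed (suc n))                ≈⟨ solve 3 (λ m s C → s :* (m :* (m :* s :* C)) := s :* (m :* (m :* s)) :* C) refl _ _ _ ⟩
    sign n * (- 1# * (- 1# * sign n)) * continuant (suc n) ≈⟨ trans (*-congʳ (sign-square n)) (*-identityˡ _) ⟩
    continuant (suc n)                              ∎
    where
    M N : Matrix (suc n)
    M i k = odd (suc (toℕ i)) (toℕ k)
    v : Fin (suc n) → Carrier
    v i = sum {suc n} λ k → M i k * signed (toℕ k)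
    N = M [ zero ]≔ v

    -- No row index exceeds n, so the right-hand side of the combination vanishes. The remaining
    -- coefficient `odd i n` is 0 for i < n and 1 for i = n, which separates `column` from `corner`.
    last-entry : ∀ (i : Fin (suc n)) → v i + odd (toℕ i) n * signed (suc n) ≈ 0#
    last-entry i = trans (odd-suc-combination (toℕ i) n)
      (trans (*-congʳ (odd-above (toℕ i) (suc n) (Fin.toℕ<n i))) (zeroˡ _))

    column : ∀ i → toℕ i ℕ.< n → v i ≈ 0#
    column i i<n = begin
      v i                                   ≈⟨ +-identityʳ _ ⟨
      v i + 0#                              ≈⟨ +-congˡ (trans (*-congʳ (odd-above (toℕ i) n i<n)) (zeroˡ _)) ⟨
      v i + odd (toℕ i) n * signed (suc n)  ≈⟨ last-entry i ⟩
      0#                                    ∎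

    corner : v (fromℕ n) ≈ - 1# * signed (suc n)
    corner = +-cancelʳ (signed (suc n)) _ _ (begin
      v (fromℕ n) + signed (suc n)                                   ≈⟨ +-congˡ (*-identityˡ _) ⟨
      v (fromℕ n) + 1# * signed (suc n)                              ≈⟨ +-congˡ (*-congʳ (odd-diagonal n)) ⟨
      v (fromℕ n) + odd n n * signed (suc n)
        ≈⟨ +-congˡ (*-congʳ (reflexive (≡.cong (λ x → odd x n) (Fin.toℕ-fromℕ n)))) ⟨
      v (fromℕ n) + odd (toℕ (fromℕ n)) n * signed (suc n)           ≈⟨ last-entry (fromℕ n) ⟩
      0#                                                             ≈⟨ x+-1*x≈0 _ ⟨
      signed (suc n) + - 1# * signed (suc n)                         ≈⟨ +-comm _ _ ⟩
      - 1# * signed (suc n) + signed (suc n)                         ∎)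

    diagonal : ∀ i (k : Fin n) → toℕ i ≡ toℕ k → M i (suc k) ≈ 1#
    diagonal i k i≡k = trans (reflexive (≡.cong (λ x → odd (suc x) (suc (toℕ k))) i≡k)) (odd-diagonal (suc (toℕ k)))
    upper : ∀ i (k : Fin n) → toℕ i ℕ.< toℕ k → M i (suc k) ≈ 0#
    upper i k i<k = odd-above (suc (toℕ i)) (suc (toℕ k)) (ℕ.s<s i<k)

  hankel₂ : ∀ n (r s : ℕ → Carrier) →
    ∣ (λ (i j : Fin n) → r (toℕ i) * s (toℕ j) * moment (suc (suc (toℕ i ℕ.+ toℕ j)))) ∣
      ≈ (product {n} λ i → r (toℕ i) * (oddNorm (toℕ i) * s (toℕ i))) * continuant n
  hankel₂ n r s = begin
    ∣ (λ (i j : Fin n) → r (toℕ i) * s (toℕ j) * moment (suc (suc (toℕ i ℕ.+ toℕ j)))) ∣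
      -- The cut is placed so that j is the bounded argument of `odd-sum-moment`; the other one, i +
      -- 1, can be as large as n.
      ≈⟨ (det-cong λ i j → trans
           (*-congˡ (trans (reflexive (≡.cong (λ x → moment (suc x)) (ℕ.+-comm (suc (toℕ i)) (toℕ j))))
             (trans (sym (odd-sum-moment n (toℕ j) (suc (toℕ i)) (Fin.toℕ<n j)))
               (odd-sum-comm n (toℕ j) (suc (toℕ i))))))
           (factor-sum {n} (r (toℕ i)) (s (toℕ j)) (odd (suc (toℕ i))) oddNorm (odd (toℕ j)))) ⟩
    ∣ (λ (i j : Fin n) → sum {n} λ k → r (toℕ i) * odd (suc (toℕ i)) (toℕ k) * (oddNorm (toℕ k) * (s (toℕ j) * odd (toℕ j) (toℕ k)))) ∣
      ≈⟨ det-*-upper {n} (λ i k → r (toℕ i) * odd (suc (toℕ i)) (toℕ k))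
           (λ k j → oddNorm (toℕ k) * (s (toℕ j) * odd (toℕ j) (toℕ k))) (λ k → oddNorm k * s k)
           (λ k j j<k → *-zero₃ _ _ (odd-above (toℕ j) (toℕ k) j<k))
           (λ j → *-congˡ (trans (*-congˡ (odd-diagonal (toℕ j))) (*-identityʳ _))) ⟩
    ∣ (λ (i k : Fin n) → r (toℕ i) * odd (suc (toℕ i)) (toℕ k)) ∣ * Πs
      ≈⟨ *-congʳ (trans (det-scale-rows (λ (i k : Fin n) → odd (suc (toℕ i)) (toℕ k)) r) (*-congˡ (det-odd-suc n))) ⟩
    product {n} (r ∘ toℕ) * continuant n * Πs
      ≈⟨ solve 3 (λ x y z → x :* y :* z := x :* z :* y) refl _ _ _ ⟩
    product {n} (r ∘ toℕ) * Πs * continuant n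
      ≈⟨ *-congʳ (product-distrib-* {n} (r ∘ toℕ) (λ k → oddNorm (toℕ k) * s (toℕ k))) ⟨
    (product {n} λ i → r (toℕ i) * (oddNorm (toℕ i) * s (toℕ i))) * continuant n ∎
    where
    Πs : Carrier
    Πs = product {n} λ k → oddNorm (toℕ k) * s (toℕ k)

-- The q-weights

module Staircase {c ℓ} (R : CommutativeRing c ℓ) where
  open CommutativeRing R hiding (zero)
  open import Algebra.Definitions.RawSemiring (Semiring.rawSemiring semiring) using (_^_; product)
  open import Algebra.Properties.CommutativeMonoid.Sum *-commutativeMonoid using ()
    renaming (∑-distrib-+ to product-distrib-*; sum-replicate to product-replicate)
  open import Relation.Binary.Reasoning.Setoid setoid

  -- The value f i occurs in the n - i partial products that reach index i. This is the origin of
  -- the exponents in both product formulas.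
  product-partial-products : ∀ (f : ℕ → Carrier) n →
    (product {n} λ i → product {suc (toℕ i)} (f ∘ toℕ)) ≈ product {n} λ i → f (toℕ i) ^ (n ∸ toℕ i)
  product-partial-products f zero    = refl
  product-partial-products f (suc n) = begin
    (product {suc n} λ i → f 0 * product {toℕ i} (f ∘ suc ∘ toℕ))
      ≈⟨ product-distrib-* {suc n} (λ _ → f 0) (λ i → product {toℕ i} (f ∘ suc ∘ toℕ)) ⟩
    product {suc n} (λ _ → f 0) * (1# * product {n} λ i → product {suc (toℕ i)} (f ∘ suc ∘ toℕ))
      ≈⟨ *-cong (product-replicate (suc n)) (trans (*-identityˡ _) (product-partial-products (f ∘ suc) n)) ⟩
    f 0 ^ suc n * (product {n} λ i → f (suc (toℕ i)) ^ (n ∸ toℕ i)) ∎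

module Specialisation {c ℓ} (R : CommutativeRing c ℓ) (q p : CommutativeRing.Carrier R)
  (qp≈1 : CommutativeRing._≈_ R (CommutativeRing._*_ R q p) (CommutativeRing.1# R)) where
  open CommutativeRing R hiding (zero)
  open import Algebra.Definitions.RawSemiring (Semiring.rawSemiring semiring) using (_^_; product)
  open import Algebra.Properties.CommutativeMonoid.Sum *-commutativeMonoid using ()
    renaming (sum-cong-≋ to product-cong; ∑-distrib-+ to product-distrib-*)
  open import Algebra.Properties.Semiring.Exp semiring using (^-homo-*; ^-assocʳ)
  open import Algebra.Properties.Semiring.Sum semiring using (sum; sum-cong-≋; *-distribˡ-sum)
  open import Algebra.Solver.Ring.NaturalCoefficients.Default commutativeSemiring
    using (solve; _:=_; _:+_; _:*_; con)
  open import Relation.Binary.Reasoning.Setoid setoid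
  open Staircase R

  Q P : Carrier
  Q = q ^ 2
  P = p ^ 2

  a b : ℕ → Carrier
  a k = P ^ k * (P ^ k * p + 1#)
  b k = P ^ k * P ^ k * (P * p)

  open DyckPaths R a b
  open HankelDeterminants R a b
  open Determinant R using (det-cong)

  level : ∀ k → b k + a (suc k) ≈ P * (a k + b k)
  level k = solve 2 (λ p x → let P = p :* (p :* con 1) in
      x :* x :* (P :* p) :+ P :* x :* (P :* x :* p :+ con 1)
        := P :* (x :* (x :* p :+ con 1) :+ x :* x :* (P :* p)))
    refl p (P ^ k)

  return : ∀ k → a (suc k) * b (suc k) ≈ P * P * (b k * a (suc k))
  return k = solve 2 (λ p x → let P = p :* (p :* con 1) in
      P :* x :* (P :* x :* p :+ con 1) :* (P :* x :* (P :* x) :* (P :* p))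
        := P :* P :* (x :* x :* (P :* p) :* (P :* x :* (P :* x :* p :+ con 1))))
    refl p (P ^ k)

  open SelfSimilar P level return

  -- Here a 0 = 1 + p and b 0 = p P. The summand p of a 0 provides the term k = 0 of the
  -- convolution, and the factor P of b 0 raises `P ^ k` to `P ^ suc k` in the remaining terms.
  moment-suc : ∀ m → moment (suc m) ≈ moment m + p * cauchy (λ k → P ^ k * moment k) moment m
  moment-suc zero = solve 2 (λ p y →
      con 1 :* (con 1 :* p :+ con 1) :* (con 1 :+ y :* con 0)
        := con 1 :+ p :* (con 1 :* con 1 :* con 1 :+ con 0))
    refl p (b 0)
  moment-suc (suc m) = begin
    moment (suc (suc m))
      ≈⟨ moment-suc-suc m ⟩
    a 0 * moment (suc m) + b 0 * C
      ≈⟨ solve 3 (λ p x y → let P = p :* (p :* con 1) in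
           con 1 :* (con 1 :* p :+ con 1) :* x :+ con 1 :* con 1 :* (P :* p) :* y
             := x :+ p :* (con 1 :* con 1 :* x :+ P :* y)) refl p (moment (suc m)) C ⟩
    moment (suc m) + p * (1# * 1# * moment (suc m) + P * C)
      ≈⟨ +-congˡ (*-congˡ (+-congˡ (cauchy-* P (λ k → P ^ k * moment (suc k)) moment m))) ⟨
    moment (suc m) + p * (1# * 1# * moment (suc m) + cauchy (λ k → P * (P ^ k * moment (suc k))) moment m)
      ≈⟨ +-congˡ (*-congˡ (+-congˡ (cauchy-cong moment (λ k → sym (*-assoc P (P ^ k) (moment (suc k)))) m))) ⟩
    moment (suc m) + p * cauchy (λ k → P ^ k * moment k) moment (suc m) ∎
    where C = cauchy (λ k → P ^ k * moment (suc k)) moment m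

  Q^*P^≈1 : ∀ k → Q ^ k * P ^ k ≈ 1#
  Q^*P^≈1 k = begin
    Q ^ k * P ^ k          ≈⟨ *-cong (^-assocʳ q 2 k) (^-assocʳ p 2 k) ⟩
    q ^ (2 ℕ.* k) * p ^ (2 ℕ.* k) ≈⟨ q^*p^≈1 (2 ℕ.* k) ⟩
    1#                     ∎
    where
    q^*p^≈1 : ∀ m → q ^ m * p ^ m ≈ 1#
    q^*p^≈1 zero    = *-identityˡ 1#
    q^*p^≈1 (suc m) = begin
      q * q ^ m * (p * p ^ m)    ≈⟨ solve 4 (λ q x p y → q :* x :* (p :* y) := q :* p :* (x :* y)) refl _ _ _ _ ⟩
      q * p * (q ^ m * p ^ m)    ≈⟨ *-cong qp≈1 (q^*p^≈1 m) ⟩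
      1# * 1#                    ≈⟨ *-identityˡ 1# ⟩
      1#                         ∎

  -- Subtraction of exponents, with the subtrahend carried by p.
  q^≈p^*q^ : ∀ {m n} i → m ℕ.+ i ≡ n → q ^ m ≈ p ^ i * q ^ n
  q^≈p^*q^ {m} zero    m≡n = sym (trans (*-identityˡ _) (reflexive (≡.cong (q ^_) (≡.trans (≡.sym m≡n) (ℕ.+-identityʳ m)))))
  q^≈p^*q^ {m} (suc i) ≡.refl = begin
    q ^ m                                ≈⟨ q^≈p^*q^ {m} i ≡.refl ⟩
    p ^ i * q ^ (m ℕ.+ i)                ≈⟨ *-identityˡ _ ⟨
    1# * (p ^ i * q ^ (m ℕ.+ i))         ≈⟨ *-congʳ qp≈1 ⟨
    q * p * (p ^ i * q ^ (m ℕ.+ i))      ≈⟨ solve 4 (λ q p x y → q :* p :* (x :* y) := p :* x :* (q :* y)) refl _ _ _ _ ⟩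
    p ^ suc i * q ^ suc (m ℕ.+ i)        ≈⟨ *-congˡ (reflexive (≡.cong (q ^_) (≡.sym (ℕ.+-suc m i)))) ⟩
    p ^ suc i * q ^ (m ℕ.+ suc i)        ∎

  q^-cong : ∀ {m n} → m ≡ n → q ^ m ≈ q ^ n
  q^-cong ≡.refl = refl

  Q^≈q^ : ∀ k → Q ^ k ≈ q ^ (2 ℕ.* k)
  Q^≈q^ = ^-assocʳ q 2

  factor : ℕ → Carrier
  factor k = q ^ (2 ℕ.* suc k ∸ 1) + 1#

  factor≈ : ∀ k → factor k ≈ q * Q ^ k + 1#
  factor≈ k = +-congʳ (begin
    q ^ (2 ℕ.* suc k ∸ 1)    ≈⟨ q^-cong (ℕ.+-suc k (k ℕ.+ 0)) ⟩
    q * q ^ (2 ℕ.* k)        ≈⟨ *-congˡ (Q^≈q^ k) ⟨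
    q * Q ^ k                ∎)

  factors : ℕ → Carrier
  factors n = product {n} (factor ∘ toℕ)

  factors-suc : ∀ n → factors (suc n) ≈ factors n * (q * Q ^ n + 1#)
  factors-suc n = trans (sum-toℕ-last *-monoid factor n) (*-congˡ (factor≈ n))

  q^-split : ∀ i {m x} → q ^ m ≈ x → q ^ (2 ℕ.* i ℕ.+ m) ≈ Q ^ i * x
  q^-split i {m} e = trans (^-homo-* q (2 ℕ.* i) m) (*-cong (sym (Q^≈q^ i)) e)

  -- A product equal to 1 that the semiring solver treats as a monomial. Since the solver cannot use
  -- q p = 1, the identities below collect all cancelling powers into copies of this monomial and
  -- replace it by 1 afterwards.
  unit : ℕ → Carrier
  unit i = Q ^ i * P ^ i * (q * p)

  unit≈1 : ∀ i → unit i ≈ 1#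
  unit≈1 i = trans (*-cong (Q^*P^≈1 i) qp≈1) (*-identityˡ 1#)

  unit³≈1 : ∀ i → unit i * unit i * unit i ≈ 1#
  unit³≈1 i = trans (*-cong (trans (*-cong (unit≈1 i) (unit≈1 i)) (*-identityˡ 1#)) (unit≈1 i)) (*-identityˡ 1#)

  -- Here a_l = p^(4l+1) (q^(2l+1) + 1) and b_l = p^(4l+3); the exponents 8l + 4 of their products
  -- add up to 4i² over l < i.
  q^4i²*evenNorm : ∀ i → q ^ (4 ℕ.* (i ℕ.* i)) * evenNorm i ≈ factors i
  q^4i²*evenNorm zero    = *-identityˡ 1#
  q^4i²*evenNorm (suc i) = begin
    q ^ (4 ℕ.* (suc i ℕ.* suc i)) * (b i * (a i * evenNorm i))
      ≈⟨ *-congʳ (q^-cong (exponents i)) ⟩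
    q ^ (4 ℕ.* (i ℕ.* i) ℕ.+ (2 ℕ.* i ℕ.+ (2 ℕ.* i ℕ.+ (2 ℕ.* i ℕ.+ (2 ℕ.* i ℕ.+ 4))))) * (b i * (a i * evenNorm i))
      ≈⟨ *-congʳ (trans (^-homo-* q (4 ℕ.* (i ℕ.* i)) _) (*-congˡ (q^-split i (q^-split i (q^-split i (q^-split i refl)))))) ⟩
    q ^ (4 ℕ.* (i ℕ.* i)) * (Q ^ i * (Q ^ i * (Q ^ i * (Q ^ i * q ^ 4)))) * (b i * (a i * evenNorm i))
      ≈⟨ solve 6 (λ e h q p X x → let P = p :* (p :* con 1) in
           e :* (X :* (X :* (X :* (X :* (q :* (q :* (q :* (q :* con 1)))))))) :* (x :* x :* (P :* p) :* (x :* (x :* p :+ con 1) :* h))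
             := e :* h :* ((X :* x :* (q :* p)) :* (X :* x :* (q :* p)) :* (X :* x :* (q :* p)) :* (q :* X :+ X :* x :* (q :* p))))
           refl (q ^ (4 ℕ.* (i ℕ.* i))) (evenNorm i) q p (Q ^ i) (P ^ i) ⟩
    q ^ (4 ℕ.* (i ℕ.* i)) * evenNorm i * (unit i * unit i * unit i * (q * Q ^ i + unit i))
      ≈⟨ *-cong (q^4i²*evenNorm i) (trans
           (*-cong (unit³≈1 i) (+-congˡ (unit≈1 i))) (*-identityˡ _)) ⟩
    factors i * (q * Q ^ i + 1#)
      ≈⟨ factors-suc i ⟨
    factors (suc i) ∎
    where
    exponents : ∀ i → 4 ℕ.* (suc i ℕ.* suc i) ≡ 4 ℕ.* (i ℕ.* i) ℕ.+ (2 ℕ.* i ℕ.+ (2 ℕ.* i ℕ.+ (2 ℕ.* i ℕ.+ (2 ℕ.* i ℕ.+ 4))))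
    exponents = ℕSolver.solve-∀

  -- The extra a_i contributes p^(4i+1), and 4i² + 4i + 1 = (2i + 1)².
  q^[2i+1]²*oddNorm : ∀ i → q ^ (4 ℕ.* (i ℕ.* i) ℕ.+ (2 ℕ.* i ℕ.+ (2 ℕ.* i ℕ.+ 1))) * oddNorm i ≈ factors (suc i)
  q^[2i+1]²*oddNorm i = begin
    q ^ (4 ℕ.* (i ℕ.* i) ℕ.+ (2 ℕ.* i ℕ.+ (2 ℕ.* i ℕ.+ 1))) * (a i * evenNorm i)
      ≈⟨ *-congʳ (trans (^-homo-* q (4 ℕ.* (i ℕ.* i)) _) (*-congˡ (q^-split i (q^-split i refl)))) ⟩
    q ^ (4 ℕ.* (i ℕ.* i)) * (Q ^ i * (Q ^ i * q ^ 1)) * (a i * evenNorm i)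
      ≈⟨ solve 6 (λ e h q p X x →
           e :* (X :* (X :* (q :* con 1))) :* (x :* (x :* p :+ con 1) :* h)
             := e :* h :* (X :* x :* (q :* X :+ X :* x :* (q :* p))))
           refl (q ^ (4 ℕ.* (i ℕ.* i))) (evenNorm i) q p (Q ^ i) (P ^ i) ⟩
    q ^ (4 ℕ.* (i ℕ.* i)) * evenNorm i * (Q ^ i * P ^ i * (q * Q ^ i + unit i))
      ≈⟨ *-cong (q^4i²*evenNorm i) (trans (*-cong (Q^*P^≈1 i) (+-congˡ (unit≈1 i))) (*-identityˡ _)) ⟩
    factors i * (q * Q ^ i + 1#)
      ≈⟨ factors-suc i ⟨
    factors (suc i) ∎

  row column : ℕ → ℕ → Carrier
  row    t i = p ^ i * q ^ rowExponent t i
  column t j = q ^ columnExponent t j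

  diagonal-scale : ∀ t i {m} x → m ℕ.+ i ≡ rowExponent t i ℕ.+ columnExponent t i →
                   row t i * (x * column t i) ≈ q ^ m * x
  diagonal-scale t i {m} x e = begin
    p ^ i * q ^ rowExponent t i * (x * q ^ columnExponent t i)
      ≈⟨ solve 4 (λ p r x c → p :* r :* (x :* c) := p :* (r :* c) :* x) refl _ _ _ _ ⟩
    p ^ i * (q ^ rowExponent t i * q ^ columnExponent t i) * x
      ≈⟨ *-congʳ (*-congˡ (^-homo-* q (rowExponent t i) _)) ⟨
    p ^ i * q ^ (rowExponent t i ℕ.+ columnExponent t i) * x
      ≈⟨ *-congʳ (q^≈p^*q^ i e) ⟨
    q ^ m * x ∎

  diagonal₀ : ∀ i → row 0 i * (evenNorm i * column 0 i) ≈ factors i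
  diagonal₀ i = trans (diagonal-scale 0 i (evenNorm i) (exponents i)) (q^4i²*evenNorm i)
    where
    exponents : ∀ i → 4 ℕ.* (i ℕ.* i) ℕ.+ i ≡ (2 ℕ.* (i ℕ.* i) ℕ.+ 0 ℕ.+ 0) ℕ.+ (2 ℕ.* (i ℕ.* i) ℕ.+ i ℕ.+ 0)
    exponents = ℕSolver.solve-∀

  diagonal₁ : ∀ i → row 1 i * (oddNorm i * column 1 i) ≈ factors (suc i)
  diagonal₁ i = trans (diagonal-scale 1 i (oddNorm i) (exponents i)) (q^[2i+1]²*oddNorm i)
    where
    exponents : ∀ i → 4 ℕ.* (i ℕ.* i) ℕ.+ (2 ℕ.* i ℕ.+ (2 ℕ.* i ℕ.+ 1)) ℕ.+ i
      ≡ (2 ℕ.* (i ℕ.* i) ℕ.+ 2 ℕ.* i ℕ.+ 1) ℕ.+ (2 ℕ.* (i ℕ.* i) ℕ.+ i ℕ.+ 2 ℕ.* i)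
    exponents = ℕSolver.solve-∀

  -- For t = 2 the row and column powers exceed what clears `oddNorm i` by q^(4i+3). This is the
  -- inverse of `b i`, which is what makes the recurrence of the continuant telescope.
  excess : ℕ → Carrier
  excess i = Q ^ i * (Q ^ i * q ^ 3)

  diagonal₂ : ∀ i → row 2 i * (oddNorm i * column 2 i) ≈ factors (suc i) * excess i
  diagonal₂ i = begin
    row 2 i * (oddNorm i * column 2 i)
      ≈⟨ diagonal-scale 2 i (oddNorm i) (exponents i) ⟩
    q ^ (m ℕ.+ (2 ℕ.* i ℕ.+ (2 ℕ.* i ℕ.+ 3))) * oddNorm i
      ≈⟨ *-congʳ (trans (^-homo-* q m _) (*-congˡ (q^-split i (q^-split i refl)))) ⟩
    q ^ m * excess i * oddNorm i
      ≈⟨ solve 3 (λ x y z → x :* y :* z := x :* z :* y) refl _ _ _ ⟩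
    q ^ m * oddNorm i * excess i
      ≈⟨ *-congʳ (q^[2i+1]²*oddNorm i) ⟩
    factors (suc i) * excess i ∎
    where
    m : ℕ
    m = 4 ℕ.* (i ℕ.* i) ℕ.+ (2 ℕ.* i ℕ.+ (2 ℕ.* i ℕ.+ 1))
    exponents : ∀ i → 4 ℕ.* (i ℕ.* i) ℕ.+ (2 ℕ.* i ℕ.+ (2 ℕ.* i ℕ.+ 1)) ℕ.+ (2 ℕ.* i ℕ.+ (2 ℕ.* i ℕ.+ 3)) ℕ.+ i
      ≡ (2 ℕ.* (i ℕ.* i) ℕ.+ 4 ℕ.* i ℕ.+ 4) ℕ.+ (2 ℕ.* (i ℕ.* i) ℕ.+ i ℕ.+ 4 ℕ.* i)
    exponents = ℕSolver.solve-∀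

  excesses : ℕ → Carrier
  excesses n = product {n} (excess ∘ toℕ)

  excesses-suc : ∀ n → excesses (suc n) ≈ excesses n * excess n
  excesses-suc = sum-toℕ-last *-monoid excess

  -- Factor by factor, q^(4l+3) a_l = q² (q^(2l+1) + 1).
  excesses*product-a : ∀ n → excesses n * product {n} (a ∘ toℕ) ≈ Q ^ n * factors n
  excesses*product-a zero    = refl
  excesses*product-a (suc n) = begin
    excesses (suc n) * product {suc n} (a ∘ toℕ)
      ≈⟨ *-cong (excesses-suc n) (sum-toℕ-last *-monoid a n) ⟩
    excesses n * excess n * (product {n} (a ∘ toℕ) * a n)
      ≈⟨ solve 6 (λ e h q p X x →
           e :* (X :* (X :* (q :* (q :* (q :* con 1))))) :* (h :* (x :* (x :* p :+ con 1)))
             := e :* h :* (q :* (q :* con 1) :* (X :* x :* (q :* X :+ X :* x :* (q :* p)))))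
           refl (excesses n) (product {n} (a ∘ toℕ)) q p (Q ^ n) (P ^ n) ⟩
    excesses n * product {n} (a ∘ toℕ) * (Q * (Q ^ n * P ^ n * (q * Q ^ n + unit n)))
      ≈⟨ *-cong (excesses*product-a n) (*-congˡ (trans (*-cong (Q^*P^≈1 n) (+-congˡ (unit≈1 n))) (*-identityˡ _))) ⟩
    Q ^ n * factors n * (Q * (q * Q ^ n + 1#))
      ≈⟨ solve 4 (λ x f y z → x :* f :* (y :* z) := y :* x :* (f :* z)) refl _ _ _ _ ⟩
    Q ^ suc n * (factors n * (q * Q ^ n + 1#))
      ≈⟨ *-congˡ (factors-suc n) ⟨
    Q ^ suc n * factors (suc n) ∎

  -- Since `excess n` inverts `b n`, the left-hand side grows by q^(2n+3) `factors (suc n)` from n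
  -- to n + 1, and so does the right-hand side. Keeping the 1 on the left avoids subtraction; it
  -- becomes the -1 of (ii).
  q*excesses*continuant+1 : ∀ n → q * (excesses n * continuant n) + 1# ≈ factors (suc n)
  q*excesses*continuant+1 zero    = begin
    q * (1# * 1#) + 1#              ≈⟨ solve 1 (λ q → q :* (con 1 :* con 1) :+ con 1 := (q :* con 1 :+ con 1) :* con 1) refl q ⟩
    (q * 1# + 1#) * 1#              ≈⟨ *-congʳ (factor≈ 0) ⟨
    factor 0 * 1#                   ∎
  q*excesses*continuant+1 (suc n) = begin
    q * (excesses (suc n) * (b n * continuant n + Π)) + 1#
      ≈⟨ solve 5 (λ q e b C Π → q :* (e :* (b :* C :+ Π)) :+ con 1 := (q :* (e :* b :* C) :+ con 1) :+ q :* (e :* Π))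
           refl q (excesses (suc n)) (b n) (continuant n) Π ⟩
    (q * (excesses (suc n) * b n * continuant n) + 1#) + q * (excesses (suc n) * Π)
      ≈⟨ +-cong (+-congʳ (*-congˡ (*-congʳ excesses*b))) (*-congˡ (excesses*product-a (suc n))) ⟩
    (q * (excesses n * continuant n) + 1#) + q * (Q ^ suc n * factors (suc n))
      ≈⟨ +-congʳ (q*excesses*continuant+1 n) ⟩
    factors (suc n) + q * (Q ^ suc n * factors (suc n))
      ≈⟨ solve 3 (λ f q x → f :+ q :* (x :* f) := f :* (q :* x :+ con 1)) refl _ _ _ ⟩
    factors (suc n) * (q * Q ^ suc n + 1#)
      ≈⟨ factors-suc (suc n) ⟨
    factors (suc (suc n)) ∎
    where
    Π : Carrier
    Π = product {suc n} (a ∘ toℕ)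
    excesses*b : excesses (suc n) * b n ≈ excesses n
    excesses*b = begin
      excesses (suc n) * b n     ≈⟨ *-congʳ (excesses-suc n) ⟩
      excesses n * excess n * b n
        ≈⟨ solve 5 (λ e q p X x →
             e :* (X :* (X :* (q :* (q :* (q :* con 1))))) :* (x :* x :* (p :* (p :* con 1) :* p))
               := e :* (X :* x :* (q :* p) :* (X :* x :* (q :* p)) :* (q :* p)))
             refl (excesses n) q p (Q ^ n) (P ^ n) ⟩
      excesses n * (unit n * unit n * (q * p))
        ≈⟨ *-congˡ (trans (*-cong (trans (*-cong (unit≈1 n) (unit≈1 n)) (*-identityˡ 1#)) qp≈1) (*-identityˡ 1#)) ⟩
      excesses n * 1#
        ≈⟨ *-identityʳ _ ⟩
      excesses n ∎

  module Determinants
    (s : ℕ → Carrier) (s-zero : s 0 ≈ 1#)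
    (s-suc : ∀ m → s (suc m) ≈ q ^ (2 ℕ.* suc m ∸ 1) * s m + sum {suc m} λ k →
       q ^ (2 ℕ.* (toℕ k ℕ.+ 1) ℕ.* (m ∸ toℕ k)) * s (m ∸ toℕ k) * s (toℕ k)) where

    -- In summand k the exponents 2(k + 1)(m - k), (m - k)² and k² add up to (m + 1)² - (2k + 1).
    -- The deficit is the power p^(2k+1) in the recurrence for the moments.
    s≈ : ∀ m → s m ≈ q ^ (m ℕ.* m) * moment m
    s≈ = <-rec _ step
      where
      step : ∀ m → (∀ {k} → k ℕ.< m → s k ≈ q ^ (k ℕ.* k) * moment k) → s m ≈ q ^ (m ℕ.* m) * moment m
      step zero    _  = trans s-zero (sym (*-identityˡ 1#))
      step (suc m) IH = begin
        s (suc m)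
          ≈⟨ s-suc m ⟩
        q ^ (2 ℕ.* suc m ∸ 1) * s m + sum {suc m} (λ k →
            q ^ (2 ℕ.* (toℕ k ℕ.+ 1) ℕ.* (m ∸ toℕ k)) * s (m ∸ toℕ k) * s (toℕ k))
          ≈⟨ +-cong first (sum-cong-≋ {suc m} λ k → summand (toℕ k) (ℕ.s≤s⁻¹ (Fin.toℕ<n k))) ⟩
        q ^ (suc m ℕ.* suc m) * moment m + sum {suc m} (λ k →
            q ^ (suc m ℕ.* suc m) * (p * (P ^ toℕ k * moment (toℕ k) * moment (m ∸ toℕ k))))
          ≈⟨ +-congˡ (*-distribˡ-sum {suc m} (q ^ (suc m ℕ.* suc m)) (λ k → p * (P ^ toℕ k * moment (toℕ k) * moment (m ∸ toℕ k)))) ⟨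
        q ^ (suc m ℕ.* suc m) * moment m + q ^ (suc m ℕ.* suc m) * sum {suc m} (λ k →
            p * (P ^ toℕ k * moment (toℕ k) * moment (m ∸ toℕ k)))
          ≈⟨ +-congˡ (*-congˡ (*-distribˡ-sum {suc m} p (λ k → P ^ toℕ k * moment (toℕ k) * moment (m ∸ toℕ k)))) ⟨
        q ^ (suc m ℕ.* suc m) * moment m + q ^ (suc m ℕ.* suc m) * (p * cauchy (λ k → P ^ k * moment k) moment m)
          ≈⟨ distribˡ _ _ _ ⟨
        q ^ (suc m ℕ.* suc m) * (moment m + p * cauchy (λ k → P ^ k * moment k) moment m)
          ≈⟨ *-congˡ (moment-suc m) ⟨
        q ^ (suc m ℕ.* suc m) * moment (suc m) ∎
        where
        first : q ^ (2 ℕ.* suc m ∸ 1) * s m ≈ q ^ (suc m ℕ.* suc m) * moment m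
        first = begin
          q ^ (2 ℕ.* suc m ∸ 1) * s m                             ≈⟨ *-congˡ (IH (ℕ.n<1+n m)) ⟩
          q ^ (2 ℕ.* suc m ∸ 1) * (q ^ (m ℕ.* m) * moment m)      ≈⟨ *-assoc _ _ _ ⟨
          q ^ (2 ℕ.* suc m ∸ 1) * q ^ (m ℕ.* m) * moment m        ≈⟨ *-congʳ (^-homo-* q (2 ℕ.* suc m ∸ 1) (m ℕ.* m)) ⟨
          q ^ (2 ℕ.* suc m ∸ 1 ℕ.+ m ℕ.* m) * moment m            ≈⟨ *-congʳ (q^-cong (exponents m)) ⟩
          q ^ (suc m ℕ.* suc m) * moment m                        ∎
          where
          exponents : ∀ m → m ℕ.+ suc (m ℕ.+ 0) ℕ.+ m ℕ.* m ≡ suc m ℕ.* suc m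
          exponents = ℕSolver.solve-∀

        summand : ∀ k → k ℕ.≤ m → q ^ (2 ℕ.* (k ℕ.+ 1) ℕ.* (m ∸ k)) * s (m ∸ k) * s k
                ≈ q ^ (suc m ℕ.* suc m) * (p * (P ^ k * moment k * moment (m ∸ k)))
        summand k k≤m = begin
          q ^ (2 ℕ.* (k ℕ.+ 1) ℕ.* j) * s j * s k
            ≈⟨ *-cong (*-congˡ (IH (ℕ.s≤s (ℕ.m∸n≤m m k)))) (IH (ℕ.s≤s k≤m)) ⟩
          q ^ (2 ℕ.* (k ℕ.+ 1) ℕ.* j) * (q ^ (j ℕ.* j) * moment j) * (q ^ (k ℕ.* k) * moment k)
            ≈⟨ solve 5 (λ x y t z u → x :* (y :* t) :* (z :* u) := x :* y :* z :* (u :* t)) refl _ _ _ _ _ ⟩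
          q ^ (2 ℕ.* (k ℕ.+ 1) ℕ.* j) * q ^ (j ℕ.* j) * q ^ (k ℕ.* k) * (moment k * moment j)
            ≈⟨ *-congʳ (trans (*-congʳ (sym (^-homo-* q (2 ℕ.* (k ℕ.+ 1) ℕ.* j) (j ℕ.* j))))
                 (sym (^-homo-* q (2 ℕ.* (k ℕ.+ 1) ℕ.* j ℕ.+ j ℕ.* j) (k ℕ.* k)))) ⟩
          q ^ (2 ℕ.* (k ℕ.+ 1) ℕ.* j ℕ.+ j ℕ.* j ℕ.+ k ℕ.* k) * (moment k * moment j)
            ≈⟨ *-congʳ (q^≈p^*q^ (suc (2 ℕ.* k)) exponents) ⟩
          p ^ suc (2 ℕ.* k) * q ^ (suc m ℕ.* suc m) * (moment k * moment j)
            ≈⟨ *-congʳ (*-congʳ (*-congˡ (^-assocʳ p 2 k))) ⟨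
          p * P ^ k * q ^ (suc m ℕ.* suc m) * (moment k * moment j)
            ≈⟨ solve 5 (λ p x y t u → p :* x :* y :* (t :* u) := y :* (p :* (x :* t :* u))) refl _ _ _ _ _ ⟩
          q ^ (suc m ℕ.* suc m) * (p * (P ^ k * moment k * moment j)) ∎
          where
          j = m ∸ k
          identity : ∀ k j → 2 ℕ.* (k ℕ.+ 1) ℕ.* j ℕ.+ j ℕ.* j ℕ.+ k ℕ.* k ℕ.+ suc (2 ℕ.* k) ≡ suc (k ℕ.+ j) ℕ.* suc (k ℕ.+ j)
          identity = ℕSolver.solve-∀
          exponents = ≡.trans (identity k j) (≡.cong (λ x → suc x ℕ.* suc x) (ℕ.m+[n∸m]≡n k≤m))

    D : ℕ → ℕ → Carrier
    D t n = det rawRing {n} λ i j → q ^ exponent (toℕ i) (toℕ j) * s (toℕ i ℕ.+ toℕ j ℕ.+ t)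

    D≈ : ∀ t n → D t n ≈ det rawRing {n} λ i j →
      row t (toℕ i) * column t (toℕ j) * moment (t ℕ.+ (toℕ i ℕ.+ toℕ j))
    D≈ t n = det-cong {n} λ i j → entry (toℕ i) (toℕ j)
      where
      entry : ∀ i j → q ^ exponent i j * s (i ℕ.+ j ℕ.+ t) ≈ row t i * column t j * moment (t ℕ.+ (i ℕ.+ j))
      entry i j = begin
        q ^ exponent i j * s n′                              ≈⟨ *-congˡ (s≈ n′) ⟩
        q ^ exponent i j * (q ^ (n′ ℕ.* n′) * moment n′)     ≈⟨ *-assoc _ _ _ ⟨
        q ^ exponent i j * q ^ (n′ ℕ.* n′) * moment n′       ≈⟨ *-congʳ (^-homo-* q (exponent i j) (n′ ℕ.* n′)) ⟨
        q ^ (exponent i j ℕ.+ n′ ℕ.* n′) * moment n′         ≈⟨ *-cong (q^≈p^*q^ i (exponent-splits t i j))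
                                                                  (reflexive (≡.cong moment (ℕ.+-comm (i ℕ.+ j) t))) ⟩
        p ^ i * q ^ (rowExponent t i ℕ.+ columnExponent t j) * moment (t ℕ.+ (i ℕ.+ j))
          ≈⟨ *-congʳ (trans (*-congˡ (^-homo-* q (rowExponent t i) (columnExponent t j))) (sym (*-assoc _ _ _))) ⟩
        row t i * column t j * moment (t ℕ.+ (i ℕ.+ j))      ∎
        where n′ = i ℕ.+ j ℕ.+ t

    D₁≈ : ∀ n → D 1 n ≈ product {n} λ i → factors (suc (toℕ i))
    D₁≈ n = trans (D≈ 1 n) (trans (hankel₁ n (row 1) (column 1))
      (product-cong {n} λ i → diagonal₁ (toℕ i)))

    -- The diagonal entries for t = 0 are those for t = 1 preceded by the empty product `factors 0`.
    D₀≈D₁ : ∀ n → D 0 (suc n) ≈ D 1 n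
    D₀≈D₁ n = begin
      D 0 (suc n)
        ≈⟨ D≈ 0 (suc n) ⟩
      det rawRing {suc n} (λ i j → row 0 (toℕ i) * column 0 (toℕ j) * moment (toℕ i ℕ.+ toℕ j))
        ≈⟨ hankel₀ (suc n) (row 0) (column 0) ⟩
      (product {suc n} λ i → row 0 (toℕ i) * (evenNorm (toℕ i) * column 0 (toℕ i)))
        ≈⟨ product-cong {suc n} {y = λ i → factors (toℕ i)} (λ i → diagonal₀ (toℕ i)) ⟩
      1# * product {n} (λ i → factors (suc (toℕ i)))
        ≈⟨ *-identityˡ _ ⟩
      product {n} (λ i → factors (suc (toℕ i)))
        ≈⟨ D₁≈ n ⟨
      D 1 n ∎

    D₀ : ∀ n → D 0 (suc n) ≈ product {n} λ i → factor (toℕ i) ^ (n ∸ toℕ i)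
    D₀ n = trans (D₀≈D₁ n) (trans (D₁≈ n) (product-partial-products factor n))

    q*D₂ : ∀ n → q * D 2 n ≈ (product {n} λ i → factor (toℕ i) ^ (n ∸ toℕ i)) * (factors (suc n) - 1#)
    q*D₂ n = begin
      q * D 2 n
        ≈⟨ *-congˡ (trans (D≈ 2 n) (hankel₂ n (row 2) (column 2))) ⟩
      q * ((product {n} λ i → row 2 (toℕ i) * (oddNorm (toℕ i) * column 2 (toℕ i))) * continuant n)
        ≈⟨ *-congˡ (*-congʳ (trans (product-cong {n} λ i → diagonal₂ (toℕ i))
             (product-distrib-* {n} (λ i → factors (suc (toℕ i))) (excess ∘ toℕ)))) ⟩
      q * ((product {n} λ i → factors (suc (toℕ i))) * excesses n * continuant n)
        ≈⟨ solve 4 (λ q x e c → q :* (x :* e :* c) := x :* (q :* (e :* c))) refl q (product {n} λ i → factors (suc (toℕ i))) (excesses n) (continuant n) ⟩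
      (product {n} λ i → factors (suc (toℕ i))) * (q * (excesses n * continuant n))
        ≈⟨ *-cong (product-partial-products factor n) (sym (trans (+-congʳ (sym (q*excesses*continuant+1 n)))
             (trans (+-assoc _ _ _) (trans (+-congˡ (-‿inverseʳ 1#)) (+-identityʳ _))))) ⟩
      (product {n} λ i → factor (toℕ i) ^ (n ∸ toℕ i)) * (factors (suc n) - 1#) ∎

-- Transfer from ℤ[q] to a ring containing q⁻¹

module _ {a ℓ₁ b ℓ₂} (M : Monoid a ℓ₁) (N : Monoid b ℓ₂) where
  private
    module M = Monoid M
    module N = Monoid N
  open import Algebra.Definitions.RawMonoid M.rawMonoid using () renaming (sum to sumᴹ; _×_ to _×ᴹ_)
  open import Algebra.Definitions.RawMonoid N.rawMonoid using () renaming (sum to sumᴺ; _×_ to _×ᴺ_)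

  module MonoidHomomorphism {⟦_⟧ : M.Carrier → N.Carrier} (hom : IsMonoidHomomorphism M.rawMonoid N.rawMonoid ⟦_⟧) where
    open IsMonoidHomomorphism hom

    sum-homo : ∀ {n} (t : Fin n → M.Carrier) → ⟦ sumᴹ t ⟧ N.≈ sumᴺ (⟦_⟧ ∘ t)
    sum-homo {zero}  t = ε-homo
    sum-homo {suc n} t = N.trans (homo (t zero) (sumᴹ (t ∘ suc))) (N.∙-congˡ (sum-homo (t ∘ suc)))

    ×-homo : ∀ n x → ⟦ n ×ᴹ x ⟧ N.≈ n ×ᴺ ⟦ x ⟧
    ×-homo zero    x = ε-homo
    ×-homo (suc n) x = N.trans (homo x (n ×ᴹ x)) (N.∙-congˡ (×-homo n x))

module RingHomomorphism {a ℓ₁ b ℓ₂} (R : CommutativeRing a ℓ₁) (R′ : CommutativeRing b ℓ₂)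
  {⟦_⟧ : CommutativeRing.Carrier R → CommutativeRing.Carrier R′}
  (hom : IsRingHomomorphism (CommutativeRing.rawRing R) (CommutativeRing.rawRing R′) ⟦_⟧) where
  private
    module R  = CommutativeRing R
    module R′ = CommutativeRing R′
  open IsRingHomomorphism hom public
  open MonoidHomomorphism R.+-monoid R′.+-monoid +-isMonoidHomomorphism public using (sum-homo)
  open MonoidHomomorphism R.*-monoid R′.*-monoid *-isMonoidHomomorphism public using ()
    renaming (sum-homo to product-homo; ×-homo to ^-homo)
  open import Algebra.Properties.CommutativeMonoid.Sum R′.+-commutativeMonoid using (sum-cong-≋)
  open import Algebra.Definitions.RawSemiring (Semiring.rawSemiring R.semiring) using (_^_; sum)
  open import Algebra.Definitions.RawSemiring (Semiring.rawSemiring R′.semiring) using () renaming (_^_ to _^′_)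

  det-homo : ∀ {n} (M : Fin n → Fin n → R.Carrier) →
             ⟦ det R.rawRing M ⟧ R′.≈ det R′.rawRing (λ i j → ⟦ M i j ⟧)
  det-homo {zero}  M = 1#-homo
  det-homo {suc n} M = R′.trans (sum-homo {suc n} (λ j → sign j R.* M zero j R.* cofactor j)) (sum-cong-≋ {suc n} term)
    where
    sign : Fin (suc n) → R.Carrier
    sign j = (R.- R.1#) ^ toℕ j
    cofactor : Fin (suc n) → R.Carrier
    cofactor j = det R.rawRing (λ i k → M (suc i) (punchIn j k))
    term : ∀ j → ⟦ sign j R.* M zero j R.* cofactor j ⟧ R′.≈
                 (R′.- R′.1#) ^′ toℕ j R′.* ⟦ M zero j ⟧ R′.* det R′.rawRing (λ i k → ⟦ M (suc i) (punchIn j k) ⟧)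
    term j = R′.trans (*-homo (sign j R.* M zero j) (cofactor j)) (R′.*-cong
      (R′.trans (*-homo (sign j) (M zero j)) (R′.*-congʳ sign-homo))
      (det-homo (λ i k → M (suc i) (punchIn j k))))
      where
      sign-homo : ⟦ sign j ⟧ R′.≈ (R′.- R′.1#) ^′ toℕ j
      sign-homo = R′.trans (^-homo (toℕ j) (R.- R.1#))
        (^-congˡ (toℕ j) (R′.trans (-‿homo R.1#) (R′.-‿cong 1#-homo)))
        where open import Algebra.Properties.Semiring.Exp R′.semiring using (^-congˡ)


-- The recurrence is solved in an extension F of R in which q is invertible.
module Extension {c ℓ c′ ℓ′} (R : CommutativeRing c ℓ) (F : CommutativeRing c′ ℓ′)
  {embed : CommutativeRing.Carrier R → CommutativeRing.Carrier F}
  (hom : IsRingHomomorphism (CommutativeRing.rawRing R) (CommutativeRing.rawRing F) embed) where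
  private
    module F = CommutativeRing F
  open CommutativeRing R hiding (zero)
  open RawSemiringDefs (Semiring.rawSemiring semiring) using (_^_; sum; product)
  open RingHomomorphism R F hom
  open RawSemiringDefs (Semiring.rawSemiring F.semiring) using ()
    renaming (_^_ to _^ᶠ_; sum to sumᶠ; product to productᶠ)
  open import Algebra.Properties.Semiring.Sum F.semiring using (sum-cong-≋)
  open import Algebra.Properties.Semiring.Exp F.semiring using (^-congˡ)
  open import Algebra.Properties.CommutativeMonoid.Sum F.*-commutativeMonoid using ()
    renaming (sum-cong-≋ to product-cong)
  open import Relation.Binary.Reasoning.Setoid F.setoid

  module Recurrence
    (embed-injective : ∀ {x y} → embed x F.≈ embed y → x ≈ y)
    (q : Carrier) (p : F.Carrier) (qp≈1 : embed q F.* p F.≈ F.1#)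
    (s : ℕ → Carrier) (s-zero : s 0 ≡ 1#)
    (s-suc : ∀ m → s (suc m) ≡ q ^ (2 ℕ.* suc m ∸ 1) * s m + sum {suc m} (λ k →
       q ^ (2 ℕ.* (toℕ k ℕ.+ 1) ℕ.* (m ∸ toℕ k)) * s (m ∸ toℕ k) * s (toℕ k))) where
    open Specialisation F (embed q) p qp≈1 using (factor; factors; module Determinants)

    embed-q^* : ∀ e f → embed (q ^ e * f) F.≈ embed q ^ᶠ e F.* embed f
    embed-q^* e f = F.trans (*-homo (q ^ e) f) (F.*-congʳ (^-homo e q))

    embed-s-suc : ∀ m → embed (s (suc m)) F.≈ embed q ^ᶠ (2 ℕ.* suc m ∸ 1) F.* embed (s m) F.+ sumᶠ {suc m} λ k →
      embed q ^ᶠ (2 ℕ.* (toℕ k ℕ.+ 1) ℕ.* (m ∸ toℕ k)) F.* embed (s (m ∸ toℕ k)) F.* embed (s (toℕ k))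
    embed-s-suc m = begin
      embed (s (suc m))
        ≈⟨ F.reflexive (≡.cong embed (s-suc m)) ⟩
      embed (q ^ (2 ℕ.* suc m ∸ 1) * s m + sum summand)
        ≈⟨ +-homo (q ^ (2 ℕ.* suc m ∸ 1) * s m) (sum summand) ⟩
      embed (q ^ (2 ℕ.* suc m ∸ 1) * s m) F.+ embed (sum summand)
        ≈⟨ F.+-cong (embed-q^* (2 ℕ.* suc m ∸ 1) (s m)) (F.trans (sum-homo summand) (sum-cong-≋ {suc m} λ k →
             F.trans (*-homo (q ^ (2 ℕ.* (toℕ k ℕ.+ 1) ℕ.* (m ∸ toℕ k)) * s (m ∸ toℕ k)) (s (toℕ k)))
               (F.*-congʳ (embed-q^* (2 ℕ.* (toℕ k ℕ.+ 1) ℕ.* (m ∸ toℕ k)) (s (m ∸ toℕ k)))))) ⟩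
      embed q ^ᶠ (2 ℕ.* suc m ∸ 1) F.* embed (s m) F.+ sumᶠ {suc m} (λ k →
        embed q ^ᶠ (2 ℕ.* (toℕ k ℕ.+ 1) ℕ.* (m ∸ toℕ k)) F.* embed (s (m ∸ toℕ k)) F.* embed (s (toℕ k))) ∎
      where
      summand : Fin (suc m) → Carrier
      summand k = q ^ (2 ℕ.* (toℕ k ℕ.+ 1) ℕ.* (m ∸ toℕ k)) * s (m ∸ toℕ k) * s (toℕ k)

    embed-s-zero : embed (s 0) F.≈ F.1#
    embed-s-zero = F.trans (F.reflexive (≡.cong embed s-zero)) 1#-homo

    open Determinants (embed ∘ s) embed-s-zero embed-s-suc

    scaledHankel : ∀ t n → Fin n → Fin n → Carrier
    scaledHankel t n i j = q ^ exponent (toℕ i) (toℕ j) * s (toℕ i ℕ.+ toℕ j ℕ.+ t)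

    embed-det : ∀ t n → embed (det rawRing (scaledHankel t n)) F.≈ D t n
    embed-det t n = F.trans (det-homo (scaledHankel t n))
      (Determinant.det-cong F {n} λ i j → embed-q^* (exponent (toℕ i) (toℕ j)) (s (toℕ i ℕ.+ toℕ j ℕ.+ t)))

    ∏[k≤_] : ℕ → (ℕ → Carrier) → Carrier
    ∏[k≤ N ] f = product {N} λ i → f (suc (toℕ i))

    q^odd+1 : ℕ → Carrier
    q^odd+1 k = q ^ (2 ℕ.* k ∸ 1) + 1#

    embed-q^odd+1 : ∀ k → embed (q^odd+1 (suc k)) F.≈ factor k
    embed-q^odd+1 k = F.trans (+-homo (q ^ (2 ℕ.* suc k ∸ 1)) 1#) (F.+-cong (^-homo (2 ℕ.* suc k ∸ 1) q) 1#-homo)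

    embed-∏ : ∀ n → embed (∏[k≤ n ] q^odd+1) F.≈ factors n
    embed-∏ n = F.trans (product-homo {n} (λ i → q^odd+1 (suc (toℕ i))))
      (product-cong {n} λ i → embed-q^odd+1 (toℕ i))

    embed-∏^ : ∀ n → embed (∏[k≤ n ] λ k → q^odd+1 k ^ (suc n ∸ k)) F.≈ productᶠ {n} λ i → factor (toℕ i) ^ᶠ (n ∸ toℕ i)
    embed-∏^ n = F.trans (product-homo {n} (λ i → q^odd+1 (suc (toℕ i)) ^ (n ∸ toℕ i)))
      (product-cong {n} λ i → F.trans (^-homo (n ∸ toℕ i) (q^odd+1 (suc (toℕ i))))
        (^-congˡ (n ∸ toℕ i) (embed-q^odd+1 (toℕ i))))

    det₁≈det₀ : ∀ n → det rawRing (scaledHankel 1 n) ≈ det rawRing (scaledHankel 0 (suc n))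
    det₁≈det₀ n = embed-injective (begin
      embed (det rawRing (scaledHankel 1 n))         ≈⟨ embed-det 1 n ⟩
      D 1 n                                   ≈⟨ D₀≈D₁ n ⟨
      D 0 (suc n)                             ≈⟨ embed-det 0 (suc n) ⟨
      embed (det rawRing (scaledHankel 0 (suc n)))   ∎)

    det₀≈∏ : ∀ n → det rawRing (scaledHankel 0 (suc n)) ≈ ∏[k≤ n ] λ k → q^odd+1 k ^ (suc n ∸ k)
    det₀≈∏ n = embed-injective (F.trans (embed-det 0 (suc n)) (F.trans (D₀ n) (F.sym (embed-∏^ n))))

    q*det₂≈ : ∀ n → q * det rawRing (scaledHankel 2 n)
                  ≈ (∏[k≤ n ] λ k → q^odd+1 k ^ (suc n ∸ k)) * (∏[k≤ suc n ] q^odd+1 - 1#)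
    q*det₂≈ n = embed-injective (begin
      embed (q * det rawRing (scaledHankel 2 n))
        ≈⟨ *-homo q (det rawRing (scaledHankel 2 n)) ⟩
      embed q F.* embed (det rawRing (scaledHankel 2 n))
        ≈⟨ F.*-congˡ (embed-det 2 n) ⟩
      embed q F.* D 2 n
        ≈⟨ q*D₂ n ⟩
      (productᶠ {n} λ i → factor (toℕ i) ^ᶠ (n ∸ toℕ i)) F.* (factors (suc n) F.- F.1#)
        ≈⟨ F.*-cong (embed-∏^ n) (F.trans (+-homo (∏[k≤ suc n ] q^odd+1) (- 1#))
             (F.+-cong (embed-∏ (suc n)) (F.trans (-‿homo 1#) (F.-‿cong 1#-homo)))) ⟨
      embed (∏[k≤ n ] λ k → q^odd+1 k ^ (suc n ∸ k)) F.* embed (∏[k≤ suc n ] q^odd+1 - 1#)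
        ≈⟨ *-homo (∏[k≤ n ] λ k → q^odd+1 k ^ (suc n ∸ k)) (∏[k≤ suc n ] q^odd+1 - 1#) ⟨
      embed ((∏[k≤ n ] λ k → q^odd+1 k ^ (suc n ∸ k)) * (∏[k≤ suc n ] q^odd+1 - 1#)) ∎)

-- Fractions with regular denominators

module TotalQuotientRing {c ℓ} (R : CommutativeRing c ℓ) where
  open CommutativeRing R renaming
    (_≈_ to _≈ᴿ_; _+_ to _+ᴿ_; _*_ to _*ᴿ_; -_ to -ᴿ_; 0# to 0ᴿ; 1# to 1ᴿ; Carrier to A)
  open import Algebra.Properties.Ring ring using (-‿distribʳ-*)
  open import Algebra.Solver.Ring.NaturalCoefficients.Default commutativeSemiring
    using (solve; _:=_; _:+_; _:*_; con)
  open import Relation.Binary.Reasoning.Setoid setoid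

  Regular : A → Set (c ⊔ ℓ)
  Regular d = ∀ x y → d *ᴿ x ≈ᴿ d *ᴿ y → x ≈ᴿ y

  regular-1 : Regular 1ᴿ
  regular-1 x y 1x≈1y = trans (sym (*-identityˡ x)) (trans 1x≈1y (*-identityˡ y))

  regular-* : ∀ {d e} → Regular d → Regular e → Regular (d *ᴿ e)
  regular-* {d} {e} rd re x y dex≈dey =
    re x y (rd (e *ᴿ x) (e *ᴿ y) (trans (sym (*-assoc d e x)) (trans dex≈dey (*-assoc d e y))))

  -- Each denominator carries the proof that it can be cancelled, so equality by
  -- cross-multiplication is transitive over any commutative ring.
  record Fraction : Set (c ⊔ ℓ) where
    constructor fraction
    field
      num     : A
      den     : A
      regular : Regular den
  open Fraction

  infix 4 _≈ᶠ_
  -- Wrapped in a record so that both fractions can be inferred from the type of an equality.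
  record _≈ᶠ_ (x y : Fraction) : Set ℓ where
    constructor cross
    field uncross : den y *ᴿ num x ≈ᴿ den x *ᴿ num y

  ring-of-fractions : CommutativeRing (c ⊔ ℓ) ℓ
  ring-of-fractions = record
    { Carrier = Fraction
    ; _≈_ = _≈ᶠ_
    ; _+_ = λ (fraction x d r) (fraction y e s) → fraction (e *ᴿ x +ᴿ d *ᴿ y) (d *ᴿ e) (regular-* r s)
    ; _*_ = λ (fraction x d r) (fraction y e s) → fraction (x *ᴿ y) (d *ᴿ e) (regular-* r s)
    ; -_  = λ (fraction x d r) → fraction (-ᴿ x) d r
    ; 0#  = fraction 0ᴿ 1ᴿ regular-1
    ; 1#  = fraction 1ᴿ 1ᴿ regular-1
    ; isCommutativeRing = record
      { isRing = record
        { +-isAbelianGroup = record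
          { isGroup = record
            { isMonoid = record
              { isSemigroup = record
                { isMagma = record
                  { isEquivalence = record
                    { refl  = cross refl
                    ; sym   = λ (cross e) → cross (sym e)
                    ; trans = λ {x} {y} {z} (cross e) (cross f) → cross (transitive x y z e f)
                    }
                  ; ∙-cong = λ {(fraction x d _)} {(fraction x′ d′ _)} {(fraction y e _)} {(fraction y′ e′ _)} (cross p) (cross q) → cross (begin
                      d′ *ᴿ e′ *ᴿ (e *ᴿ x +ᴿ d *ᴿ y)
                        ≈⟨ solve 6 (λ d d′ e e′ x y → d′ :* e′ :* (e :* x :+ d :* y) := e :* e′ :* (d′ :* x) :+ d :* d′ :* (e′ :* y)) refl d d′ e e′ x y ⟩
                      e *ᴿ e′ *ᴿ (d′ *ᴿ x) +ᴿ d *ᴿ d′ *ᴿ (e′ *ᴿ y)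
                        ≈⟨ +-cong (*-congˡ p) (*-congˡ q) ⟩
                      e *ᴿ e′ *ᴿ (d *ᴿ x′) +ᴿ d *ᴿ d′ *ᴿ (e *ᴿ y′)
                        ≈⟨ solve 6 (λ d d′ e e′ x y → e :* e′ :* (d :* x) :+ d :* d′ :* (e :* y) := d :* e :* (e′ :* x :+ d′ :* y)) refl d d′ e e′ x′ y′ ⟩
                      d *ᴿ e *ᴿ (e′ *ᴿ x′ +ᴿ d′ *ᴿ y′) ∎)
                  }
                ; assoc = λ (fraction x d _) (fraction y e _) (fraction z f _) → cross
                    (solve 6 (λ d e f x y z →
                      d :* (e :* f) :* (f :* (e :* x :+ d :* y) :+ d :* e :* z)
                        := d :* e :* f :* (e :* f :* x :+ d :* (f :* y :+ e :* z))) refl d e f x y z)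
                }
              ; identity
                  = (λ (fraction x d _) → cross (solve 2 (λ d x → d :* (d :* con 0 :+ con 1 :* x) := con 1 :* d :* x) refl d x))
                  , (λ (fraction x d _) → cross (solve 2 (λ d x → d :* (con 1 :* x :+ d :* con 0) := d :* con 1 :* x) refl d x))
              }
            ; inverse
                = (λ (fraction x d _) → cross (cancel d x))
                , (λ (fraction x d _) → cross (trans (*-congˡ (+-comm _ _)) (cancel d x)))
            ; ⁻¹-cong = λ {(fraction x d _)} {(fraction y e _)} (cross p) →
                cross (trans (sym (-‿distribʳ-* e x)) (trans (-‿cong p) (-‿distribʳ-* d y)))
            }
          ; comm = λ (fraction x d _) (fraction y e _) → cross
              (solve 4 (λ d e x y → e :* d :* (e :* x :+ d :* y) := d :* e :* (d :* y :+ e :* x)) refl d e x y)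
          }
        ; *-cong = λ {(fraction x d _)} {(fraction x′ d′ _)} {(fraction y e _)} {(fraction y′ e′ _)} (cross p) (cross q) → cross (begin
            d′ *ᴿ e′ *ᴿ (x *ᴿ y)      ≈⟨ solve 4 (λ d e x y → d :* e :* (x :* y) := d :* x :* (e :* y)) refl d′ e′ x y ⟩
            d′ *ᴿ x *ᴿ (e′ *ᴿ y)      ≈⟨ *-cong p q ⟩
            d *ᴿ x′ *ᴿ (e *ᴿ y′)      ≈⟨ solve 4 (λ d e x y → d :* e :* (x :* y) := d :* x :* (e :* y)) refl d e x′ y′ ⟨
            d *ᴿ e *ᴿ (x′ *ᴿ y′)      ∎)
        ; *-assoc = λ (fraction x d _) (fraction y e _) (fraction z f _) → cross
            (solve 6 (λ d e f x y z → d :* (e :* f) :* (x :* y :* z) := d :* e :* f :* (x :* (y :* z))) refl d e f x y z)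
        ; *-identity
            = (λ (fraction x d _) → cross (solve 2 (λ d x → d :* (con 1 :* x) := con 1 :* d :* x) refl d x))
            , (λ (fraction x d _) → cross (solve 2 (λ d x → d :* (x :* con 1) := d :* con 1 :* x) refl d x))
        ; distrib
            = (λ (fraction x d _) (fraction y e _) (fraction z f _) → cross
                (solve 6 (λ d e f x y z →
                  d :* e :* (d :* f) :* (x :* (f :* y :+ e :* z))
                    := d :* (e :* f) :* (d :* f :* (x :* y) :+ d :* e :* (x :* z))) refl d e f x y z))
            , (λ (fraction x d _) (fraction y e _) (fraction z f _) → cross
                (solve 6 (λ d e f x y z →
                  e :* d :* (f :* d) :* ((f :* y :+ e :* z) :* x)
                    := e :* f :* d :* (f :* d :* (y :* x) :+ e :* d :* (z :* x))) refl d e f x y z))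
        }
      ; *-comm = λ (fraction x d _) (fraction y e _) → cross
          (solve 4 (λ d e x y → e :* d :* (x :* y) := d :* e :* (y :* x)) refl d e x y)
      }
    }
    where
    transitive : ∀ x y z → den y *ᴿ num x ≈ᴿ den x *ᴿ num y → den z *ᴿ num y ≈ᴿ den y *ᴿ num z →
                 den z *ᴿ num x ≈ᴿ den x *ᴿ num z
    transitive (fraction x d _) (fraction y e reg) (fraction z f _) p q = reg _ _ (begin
      e *ᴿ (f *ᴿ x)     ≈⟨ solve 3 (λ a b c → a :* (b :* c) := b :* (a :* c)) refl e f x ⟩
      f *ᴿ (e *ᴿ x)     ≈⟨ *-congˡ p ⟩
      f *ᴿ (d *ᴿ y)     ≈⟨ solve 3 (λ a b c → a :* (b :* c) := b :* (a :* c)) refl f d y ⟩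
      d *ᴿ (f *ᴿ y)     ≈⟨ *-congˡ q ⟩
      d *ᴿ (e *ᴿ z)     ≈⟨ solve 3 (λ a b c → a :* (b :* c) := b :* (a :* c)) refl d e z ⟩
      e *ᴿ (d *ᴿ z)     ∎)
    cancel : ∀ d x → 1ᴿ *ᴿ (d *ᴿ (-ᴿ x) +ᴿ d *ᴿ x) ≈ᴿ d *ᴿ d *ᴿ 0ᴿ
    cancel d x = begin
      1ᴿ *ᴿ (d *ᴿ (-ᴿ x) +ᴿ d *ᴿ x)   ≈⟨ solve 3 (λ d x y → con 1 :* (d :* x :+ d :* y) := d :* (x :+ y)) refl d (-ᴿ x) x ⟩
      d *ᴿ (-ᴿ x +ᴿ x)                ≈⟨ *-congˡ (-‿inverseˡ x) ⟩
      d *ᴿ 0ᴿ                         ≈⟨ solve 1 (λ d → d :* con 0 := d :* d :* con 0) refl d ⟩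
      d *ᴿ d *ᴿ 0ᴿ                    ∎

  embed : A → Fraction
  embed x = fraction x 1ᴿ regular-1

  embed-injective : ∀ {x y} → embed x ≈ᶠ embed y → x ≈ᴿ y
  embed-injective (cross e) = regular-1 _ _ e

  embed-isRingHomomorphism : IsRingHomomorphism rawRing (CommutativeRing.rawRing ring-of-fractions) embed
  embed-isRingHomomorphism = record
    { isSemiringHomomorphism = record
      { isNearSemiringHomomorphism = record
        { +-isMonoidHomomorphism = record
          { isMagmaHomomorphism = record
            { isRelHomomorphism = record { cong = λ x≈y → cross (*-congˡ x≈y) }
            ; homo = λ x y → cross (solve 2 (λ x y → con 1 :* con 1 :* (x :+ y) := con 1 :* (con 1 :* x :+ con 1 :* y)) refl x y)
            }
          ; ε-homo = cross refl
          }
        ; *-homo = λ x y → cross (*-congʳ (*-identityˡ 1ᴿ))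
        }
      ; 1#-homo = cross refl
      }
    ; -‿homo = λ x → cross refl
    }

  reciprocal : ∀ x → Regular x → Fraction
  reciprocal x r = fraction 1ᴿ x r

  x*1/x≈1 : ∀ x r → (CommutativeRing._*_ ring-of-fractions (embed x) (reciprocal x r)) ≈ᶠ embed 1ᴿ
  x*1/x≈1 x r = cross (solve 1 (λ x → con 1 :* (x :* con 1) := con 1 :* x :* con 1) refl x)

open import Defs

-- The commutative ring ℤ[q] of coefficient lists

module PolynomialRing where
  open ≡ using (refl; sym; trans; cong; cong₂)
  open ≡.≡-Reasoning

  -- The recursion of list multiplication, transported to coefficient sequences: there equality is
  -- pointwise and trailing zeros are invisible, so the ring laws are proved for sequences and
  -- pulled back along `coeff`.
  convolution : (ℕ → ℤ) → (ℕ → ℤ) → ℕ → ℤ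
  convolution u v zero    = u 0 ℤ.* v 0
  convolution u v (suc k) = u 0 ℤ.* v (suc k) ℤ.+ convolution (u ∘ suc) v k

  coeff-+ : ∀ f g k → coeff (f + g) k ≡ coeff f k ℤ.+ coeff g k
  coeff-+ []      g       k       = sym (ℤ.+-identityˡ _)
  coeff-+ (a ∷ f) []      k       = sym (ℤ.+-identityʳ _)
  coeff-+ (a ∷ f) (b ∷ g) zero    = refl
  coeff-+ (a ∷ f) (b ∷ g) (suc k) = coeff-+ f g k

  coeff-map : ∀ {h : ℤ → ℤ} → h 0ℤ ≡ 0ℤ → ∀ f k → coeff (map h f) k ≡ h (coeff f k)
  coeff-map h0 []      k       = sym h0
  coeff-map h0 (a ∷ f) zero    = refl
  coeff-map h0 (a ∷ f) (suc k) = coeff-map h0 f k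

  convolution-zeroˡ : ∀ v k → convolution (λ _ → 0ℤ) v k ≡ 0ℤ
  convolution-zeroˡ v zero    = refl
  convolution-zeroˡ v (suc k) = trans (ℤ.+-identityˡ _) (convolution-zeroˡ v k)

  coeff-* : ∀ f g k → coeff (f * g) k ≡ convolution (coeff f) (coeff g) k
  coeff-* []      g k       = sym (convolution-zeroˡ (coeff g) k)
  coeff-* (a ∷ f) g zero    = begin
    coeff (map (a ℤ.*_) g + (0ℤ ∷ f * g)) 0  ≡⟨ coeff-+ (map (a ℤ.*_) g) (0ℤ ∷ f * g) 0 ⟩
    coeff (map (a ℤ.*_) g) 0 ℤ.+ 0ℤ          ≡⟨ ℤ.+-identityʳ _ ⟩
    coeff (map (a ℤ.*_) g) 0                 ≡⟨ coeff-map (ℤ.*-zeroʳ a) g 0 ⟩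
    a ℤ.* coeff g 0                          ∎
  coeff-* (a ∷ f) g (suc k) = begin
    coeff (map (a ℤ.*_) g + (0ℤ ∷ f * g)) (suc k)          ≡⟨ coeff-+ (map (a ℤ.*_) g) (0ℤ ∷ f * g) (suc k) ⟩
    coeff (map (a ℤ.*_) g) (suc k) ℤ.+ coeff (f * g) k     ≡⟨ cong₂ ℤ._+_ (coeff-map (ℤ.*-zeroʳ a) g (suc k)) (coeff-* f g k) ⟩
    a ℤ.* coeff g (suc k) ℤ.+ convolution (coeff f) (coeff g) k ∎

  convolution-cong : ∀ {u u′ v v′} → (∀ k → u k ≡ u′ k) → (∀ k → v k ≡ v′ k) →
                     ∀ k → convolution u v k ≡ convolution u′ v′ k
  convolution-cong u≡ v≡ zero    = cong₂ ℤ._*_ (u≡ 0) (v≡ 0)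
  convolution-cong u≡ v≡ (suc k) =
    cong₂ ℤ._+_ (cong₂ ℤ._*_ (u≡ 0) (v≡ (suc k))) (convolution-cong (u≡ ∘ suc) v≡ k)

  -- Splits off the term at the opposite end from the definition. Commutativity rests on this, as
  -- exchanging the factors exchanges the two ends.
  convolution-sucʳ : ∀ u v k → convolution u v (suc k) ≡ convolution u (v ∘ suc) k ℤ.+ u (suc k) ℤ.* v 0
  convolution-sucʳ u v zero    = refl
  convolution-sucʳ u v (suc k) = begin
    u 0 ℤ.* v (suc (suc k)) ℤ.+ convolution (u ∘ suc) v (suc k)
      ≡⟨ cong (λ z → u 0 ℤ.* v (suc (suc k)) ℤ.+ z) (convolution-sucʳ (u ∘ suc) v k) ⟩
    u 0 ℤ.* v (suc (suc k)) ℤ.+ (convolution (u ∘ suc) (v ∘ suc) k ℤ.+ u (suc (suc k)) ℤ.* v 0)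
      ≡⟨ ℤ.+-assoc (u 0 ℤ.* v (suc (suc k))) _ _ ⟨
    u 0 ℤ.* v (suc (suc k)) ℤ.+ convolution (u ∘ suc) (v ∘ suc) k ℤ.+ u (suc (suc k)) ℤ.* v 0 ∎

  convolution-comm : ∀ u v k → convolution u v k ≡ convolution v u k
  convolution-comm u v zero    = ℤ.*-comm (u 0) (v 0)
  convolution-comm u v (suc k) = begin
    u 0 ℤ.* v (suc k) ℤ.+ convolution (u ∘ suc) v k  ≡⟨ ℤ.+-comm (u 0 ℤ.* v (suc k)) _ ⟩
    convolution (u ∘ suc) v k ℤ.+ u 0 ℤ.* v (suc k)  ≡⟨ cong₂ ℤ._+_ (convolution-comm (u ∘ suc) v k) (ℤ.*-comm (u 0) (v (suc k))) ⟩
    convolution v (u ∘ suc) k ℤ.+ v (suc k) ℤ.* u 0  ≡⟨ convolution-sucʳ v u k ⟨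
    convolution v u (suc k)                          ∎

  convolution-+ˡ : ∀ u v w k → convolution (λ i → u i ℤ.+ v i) w k ≡ convolution u w k ℤ.+ convolution v w k
  convolution-+ˡ u v w zero    = ℤ.*-distribʳ-+ (w 0) (u 0) (v 0)
  convolution-+ˡ u v w (suc k) = begin
    (u 0 ℤ.+ v 0) ℤ.* w (suc k) ℤ.+ convolution (λ i → u (suc i) ℤ.+ v (suc i)) w k
      ≡⟨ cong (λ z → (u 0 ℤ.+ v 0) ℤ.* w (suc k) ℤ.+ z) (convolution-+ˡ (u ∘ suc) (v ∘ suc) w k) ⟩
    (u 0 ℤ.+ v 0) ℤ.* w (suc k) ℤ.+ (convolution (u ∘ suc) w k ℤ.+ convolution (v ∘ suc) w k)
      ≡⟨ rearrange (u 0) (v 0) (w (suc k)) _ _ ⟩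
    u 0 ℤ.* w (suc k) ℤ.+ convolution (u ∘ suc) w k ℤ.+ (v 0 ℤ.* w (suc k) ℤ.+ convolution (v ∘ suc) w k) ∎
    where
    rearrange : ∀ a b c x y → (a ℤ.+ b) ℤ.* c ℤ.+ (x ℤ.+ y) ≡ a ℤ.* c ℤ.+ x ℤ.+ (b ℤ.* c ℤ.+ y)
    rearrange = ℤSolver.solve-∀

  convolution-*ˡ : ∀ a v w k → convolution (λ i → a ℤ.* v i) w k ≡ a ℤ.* convolution v w k
  convolution-*ˡ a v w zero    = ℤ.*-assoc a (v 0) (w 0)
  convolution-*ˡ a v w (suc k) = trans
    (cong₂ ℤ._+_ (ℤ.*-assoc a (v 0) (w (suc k))) (convolution-*ˡ a (v ∘ suc) w k))
    (sym (ℤ.*-distribˡ-+ a (v 0 ℤ.* w (suc k)) (convolution (v ∘ suc) w k)))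

  convolution-assoc : ∀ u v w k → convolution (convolution u v) w k ≡ convolution u (convolution v w) k
  convolution-assoc u v w zero    = ℤ.*-assoc (u 0) (v 0) (w 0)
  convolution-assoc u v w (suc k) = begin
    u 0 ℤ.* v 0 ℤ.* w (suc k) ℤ.+ convolution (λ i → u 0 ℤ.* v (suc i) ℤ.+ convolution (u ∘ suc) v i) w k
      ≡⟨ cong (λ z → u 0 ℤ.* v 0 ℤ.* w (suc k) ℤ.+ z) (convolution-+ˡ (λ i → u 0 ℤ.* v (suc i)) _ w k) ⟩
    u 0 ℤ.* v 0 ℤ.* w (suc k) ℤ.+ (convolution (λ i → u 0 ℤ.* v (suc i)) w k ℤ.+ convolution (convolution (u ∘ suc) v) w k)
      ≡⟨ cong (λ z → u 0 ℤ.* v 0 ℤ.* w (suc k) ℤ.+ z)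
           (cong₂ ℤ._+_ (convolution-*ˡ (u 0) (v ∘ suc) w k) (convolution-assoc (u ∘ suc) v w k)) ⟩
    u 0 ℤ.* v 0 ℤ.* w (suc k) ℤ.+ (u 0 ℤ.* convolution (v ∘ suc) w k ℤ.+ convolution (u ∘ suc) (convolution v w) k)
      ≡⟨ rearrange (u 0) (v 0) (w (suc k)) _ _ ⟩
    u 0 ℤ.* (v 0 ℤ.* w (suc k) ℤ.+ convolution (v ∘ suc) w k) ℤ.+ convolution (u ∘ suc) (convolution v w) k ∎
    where
    rearrange : ∀ a b c x y → a ℤ.* b ℤ.* c ℤ.+ (a ℤ.* x ℤ.+ y) ≡ a ℤ.* (b ℤ.* c ℤ.+ x) ℤ.+ y
    rearrange = ℤSolver.solve-∀

  convolution-identityˡ : ∀ v k → convolution (coeff 1#) v k ≡ v k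
  convolution-identityˡ v zero    = ℤ.*-identityˡ (v 0)
  convolution-identityˡ v (suc k) = trans
    (cong₂ ℤ._+_ (ℤ.*-identityˡ (v (suc k))) (convolution-zeroˡ v k))
    (ℤ.+-identityʳ (v (suc k)))

  +-cong : ∀ {f f′ g g′} → f ≈ f′ → g ≈ g′ → f + g ≈ f′ + g′
  +-cong {f} {f′} {g} {g′} f≈ g≈ k =
    trans (coeff-+ f g k) (trans (cong₂ ℤ._+_ (f≈ k) (g≈ k)) (sym (coeff-+ f′ g′ k)))

  +-comm : ∀ f g → f + g ≈ g + f
  +-comm f g k = trans (coeff-+ f g k) (trans (ℤ.+-comm (coeff f k) _) (sym (coeff-+ g f k)))

  +-assoc : ∀ f g h → (f + g) + h ≈ f + (g + h)
  +-assoc f g h k = begin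
    coeff (f + g + h) k                          ≡⟨ coeff-+ (f + g) h k ⟩
    coeff (f + g) k ℤ.+ coeff h k                ≡⟨ cong (ℤ._+ coeff h k) (coeff-+ f g k) ⟩
    coeff f k ℤ.+ coeff g k ℤ.+ coeff h k        ≡⟨ ℤ.+-assoc (coeff f k) _ _ ⟩
    coeff f k ℤ.+ (coeff g k ℤ.+ coeff h k)      ≡⟨ cong (λ z → coeff f k ℤ.+ z) (coeff-+ g h k) ⟨
    coeff f k ℤ.+ coeff (g + h) k                ≡⟨ coeff-+ f (g + h) k ⟨
    coeff (f + (g + h)) k                        ∎

  +-identityʳ : ∀ f → f + 0# ≈ f
  +-identityʳ f k = trans (coeff-+ f 0# k) (ℤ.+-identityʳ (coeff f k))

  coeff-neg : ∀ f k → coeff (- f) k ≡ ℤ.- coeff f k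
  coeff-neg = coeff-map refl

  -‿cong : ∀ {f g} → f ≈ g → - f ≈ - g
  -‿cong {f} {g} f≈g k = trans (coeff-neg f k) (trans (cong ℤ.-_ (f≈g k)) (sym (coeff-neg g k)))

  -‿inverseʳ : ∀ f → f + - f ≈ 0#
  -‿inverseʳ f k = trans (coeff-+ f (- f) k)
    (trans (cong (λ z → coeff f k ℤ.+ z) (coeff-neg f k)) (ℤ.+-inverseʳ (coeff f k)))

  *-cong : ∀ {f f′ g g′} → f ≈ f′ → g ≈ g′ → f * g ≈ f′ * g′
  *-cong {f} {f′} {g} {g′} f≈ g≈ k =
    trans (coeff-* f g k) (trans (convolution-cong f≈ g≈ k) (sym (coeff-* f′ g′ k)))

  *-comm : ∀ f g → f * g ≈ g * f
  *-comm f g k =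
    trans (coeff-* f g k) (trans (convolution-comm (coeff f) (coeff g) k) (sym (coeff-* g f k)))

  *-assoc : ∀ f g h → (f * g) * h ≈ f * (g * h)
  *-assoc f g h k = begin
    coeff (f * g * h) k                                               ≡⟨ coeff-* (f * g) h k ⟩
    convolution (coeff (f * g)) (coeff h) k                           ≡⟨ convolution-cong (coeff-* f g) (λ _ → refl) k ⟩
    convolution (convolution (coeff f) (coeff g)) (coeff h) k         ≡⟨ convolution-assoc (coeff f) _ _ k ⟩
    convolution (coeff f) (convolution (coeff g) (coeff h)) k         ≡⟨ convolution-cong (λ _ → refl) (coeff-* g h) k ⟨
    convolution (coeff f) (coeff (g * h)) k                           ≡⟨ coeff-* f (g * h) k ⟨
    coeff (f * (g * h)) k                                             ∎

  *-identityˡ : ∀ f → 1# * f ≈ f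
  *-identityˡ f k = trans (coeff-* 1# f k) (convolution-identityˡ (coeff f) k)

  *-distribʳ-+ : ∀ f g h → (g + h) * f ≈ g * f + h * f
  *-distribʳ-+ f g h k = begin
    coeff ((g + h) * f) k                                            ≡⟨ coeff-* (g + h) f k ⟩
    convolution (coeff (g + h)) (coeff f) k                          ≡⟨ convolution-cong (coeff-+ g h) (λ _ → refl) k ⟩
    convolution (λ i → coeff g i ℤ.+ coeff h i) (coeff f) k          ≡⟨ convolution-+ˡ (coeff g) _ _ k ⟩
    convolution (coeff g) (coeff f) k ℤ.+ convolution (coeff h) (coeff f) k
      ≡⟨ cong₂ ℤ._+_ (coeff-* g f k) (coeff-* h f k) ⟨
    coeff (g * f) k ℤ.+ coeff (h * f) k                              ≡⟨ coeff-+ (g * f) (h * f) k ⟨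
    coeff (g * f + h * f) k                                          ∎

  *-distribˡ-+ : ∀ f g h → f * (g + h) ≈ f * g + f * h
  *-distribˡ-+ f g h k = begin
    coeff (f * (g + h)) k      ≡⟨ *-comm f (g + h) k ⟩
    coeff ((g + h) * f) k      ≡⟨ *-distribʳ-+ f g h k ⟩
    coeff (g * f + h * f) k    ≡⟨ +-cong {g * f} {f * g} {h * f} {f * h} (*-comm g f) (*-comm h f) k ⟩
    coeff (f * g + f * h) k    ∎

  commutativeRing : CommutativeRing 0ℓ 0ℓ
  commutativeRing = record
    { RawRing ℤ[q]
    ; isCommutativeRing = record
      { isRing = record
        { +-isAbelianGroup = record
          { isGroup = record
            { isMonoid = record
              { isSemigroup = record
                { isMagma = record
                  { isEquivalence = record
                    { refl  = λ _ → refl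
                    ; sym   = λ f≈g k → sym (f≈g k)
                    ; trans = λ f≈g g≈h k → trans (f≈g k) (g≈h k)
                    }
                  ; ∙-cong = λ {f} {f′} {g} {g′} → +-cong {f} {f′} {g} {g′}
                  }
                ; assoc = +-assoc
                }
              ; identity = (λ _ _ → refl) , +-identityʳ
              }
            ; inverse = (λ f k → trans (+-comm (- f) f k) (-‿inverseʳ f k)) , -‿inverseʳ
            ; ⁻¹-cong = λ {f} {g} → -‿cong {f} {g}
            }
          ; comm = +-comm
          }
        ; *-cong = λ {f} {f′} {g} {g′} → *-cong {f} {f′} {g} {g′}
        ; *-assoc = *-assoc
        ; *-identity = *-identityˡ , λ f k → trans (*-comm f 1# k) (*-identityˡ f k)
        ; distrib = *-distribˡ-+ , *-distribʳ-+
        }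
      ; *-comm = *-comm
      }
    }

  coeff-q* : ∀ f k → coeff (q * f) (suc k) ≡ coeff f k
  coeff-q* f k = begin
    coeff (q * f) (suc k)                             ≡⟨ coeff-* q f (suc k) ⟩
    0ℤ ℤ.+ convolution (coeff 1#) (coeff f) k         ≡⟨ ℤ.+-identityˡ _ ⟩
    convolution (coeff 1#) (coeff f) k                ≡⟨ convolution-identityˡ (coeff f) k ⟩
    coeff f k                                         ∎

  -- Multiplication by q shifts the coefficients. This is the regularity of q that admits it as a
  -- denominator.
  q*-cancelˡ : ∀ f g → q * f ≈ q * g → f ≈ g
  q*-cancelˡ f g qf≈qg k = trans (sym (coeff-q* f k)) (trans (qf≈qg (suc k)) (coeff-q* g k))

-- The determinant formulas in ℤ[q] and ℤ[q,q⁻¹]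

theorem5p3 : ∀ (n : ℕ) → .{{NonZero n}} →
    ( (det ℤ[q] (S-matrix 1 (n ∸ 1)) ≈ det ℤ[q] (S-matrix 0 n))
    × (det ℤ[q] (S-matrix 0 n)
         ≈ ∏[1≤k≤ n ∸ 1 ] (λ k → (q ^ (2 ℕ.* k ∸ 1) + 1#) ^ (n ∸ k))) )
    × (ι (det ℤ[q] (S-matrix 2 n))
         ≈ᴸ q⁻¹ *ᴸ ι (∏[1≤k≤ n ] (λ k → (q ^ (2 ℕ.* k ∸ 1) + 1#) ^ (n ℕ.+ 1 ∸ k))
                       * (∏[1≤k≤ n ℕ.+ 1 ] (λ k → q ^ (2 ℕ.* k ∸ 1) + 1#) - 1#)))
theorem5p3 zero    = contradiction ≡.refl (ℕ.≢-nonZero⁻¹ 0)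
theorem5p3 (suc n) = (det₁≈det₀ n , det₀≈∏ n) , λ k → begin
  -- The Laurent equality unfolds to `q ^ 1 * det₂ ≈ q ^ 0 * (1# * X)`, compared coefficient by
  -- coefficient.
  coeff (q * 1# * det₂) k       ≡⟨ ℤq.*-congʳ {det₂} {q * 1#} {q} (ℤq.*-identityʳ q) k ⟩
  coeff (q * det₂) k            ≡⟨ ≡.subst (λ m → q * det₂ ≈ rhs m) (ℕ.+-comm 1 (suc n)) (q*det₂≈ (suc n)) k ⟩
  coeff X k                     ≡⟨ ℤq.*-identityˡ X k ⟨
  coeff (1# * X) k              ≡⟨ ℤq.*-identityˡ (1# * X) k ⟨
  coeff (1# * (1# * X)) k       ∎
  where
  open TotalQuotientRing PolynomialRing.commutativeRing
  open Extension PolynomialRing.commutativeRing ring-of-fractions embed-isRingHomomorphism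
  open Recurrence embed-injective q (reciprocal q PolynomialRing.q*-cancelˡ) (x*1/x≈1 q PolynomialRing.q*-cancelˡ)
    S ≡.refl S-suc
    using (det₁≈det₀; det₀≈∏; q*det₂≈)
  open ≡.≡-Reasoning
  module ℤq = CommutativeRing PolynomialRing.commutativeRing
  det₂ : Poly
  det₂ = det ℤ[q] (S-matrix 2 (suc n))
  -- The sum `suc n ℕ.+ 1` does not reduce to `suc (suc n)`; abstracting both of its occurrences
  -- allows one rewriting by commutativity.
  rhs : ℕ → Poly
  rhs m = ∏[1≤k≤ suc n ] (λ k → (q ^ (2 ℕ.* k ∸ 1) + 1#) ^ (m ∸ k))
            * (∏[1≤k≤ m ] (λ k → q ^ (2 ℕ.* k ∸ 1) + 1#) - 1#)
  X : Poly
  X = rhs (suc n ℕ.+ 1)
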